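{- Let $\eta\geq 1$ be a fixed integer and $f=X^{2^\eta}+1$. For integers $N\geq1$ put $\ell_f(N)=\operatorname{rad}\operatorname{lcm}\{f(1),\ldots,f(N)\}$ (the product of the distinct primes dividing $f(1)\cdots f(N)$). Then there is a constant $C_\eta>0$ depending only on $\eta$ such that for all integers $N\geq 2$, \[ \log \ell_f(N)\;\geq\;\frac{2^\eta-1}{\eta\, 2^{\eta-1}}\,N\log N - C_\eta N . \]
   Context: $\operatorname{rad}(m)$ denotes the product of the distinct primes dividing the nonzero integer $m$. -}

module Defs where

open import Data.Nat using (ℕ; zero; suc; _+_; _*_; _∸_; _^_)
open import Data.Nat.Divisibility using (_∣_; _∣?_)
open import Data.Nat.Primality using (Prime; prime?)
open import Data.List using (List; filter; upTo)
open import Data.Nat.ListAction using (product)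
open import Data.Product using (_×_)
open import Relation.Nullary.Decidable using (_×-dec_)

-- The list of primes p with p ∣ m, each listed once (searched in 0..m).
-- For m ≥ 1 every prime divisor of m is ≤ m, so this is complete.
primeDivisors : ℕ → List ℕ
primeDivisors m = filter (λ p → prime? p ×-dec (p ∣? m)) (upTo (suc m))

rad : ℕ → ℕ
rad m = product (primeDivisors m)

fη : ℕ → ℕ → ℕ
fη η x = x ^ (2 ^ η) + 1

prodF : ℕ → ℕ → ℕ
prodF η zero = 1
prodF η (suc N) = prodF η N * fη η (suc N)

-- ℓ_f(N) = rad lcm{f(1),...,f(N)} = rad (f(1) ⋯ f(N))
ℓf : ℕ → ℕ → ℕ
ℓf η N = rad (prodF η N)

{-# OPTIONS --safe #-}
module Submission where

-- Let d = 2^η and P = f(1)⋯f(N) ≥ (N!)^d, so log P ≥ d N log N - O(N).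
--
-- A prime p > 2N has multiplicity at most η 2^(η-1) in P.  Indeed, if
-- 2^e ≤ k < 2^(e+1), then the n ≤ N with pᵏ ∣ f(n) have distinct 2^(e+1)-st
-- powers modulo pᵏ, and these are roots of X^(2^(η-1-e)) + 1; so there are at
-- most 2^(η-1-e) such n, and k < d.
--
-- It remains to bound the contribution of the primes p ≤ 2N to log P by
-- N log N + O(N).  Up to error terms of Chebyshev type it is the sum of
-- d (N/pᵏ) log p over the prime powers pᵏ ≤ 2N with p ≡ 1 mod 2d.  Instead of
-- Mertens' theorem in arithmetic progressions we use the ring ℤ[ζ] =
-- ℤ[X]/(X^d + 1).  Take the x ≍ N elements with coefficients in [0, x^(1/d)).
-- The norm of a difference of two of them is O(x), so the product W of the
-- norms of all differences is at most (C x)^(x²).  On the other hand X^d + 1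
-- has d roots modulo pᵏ, and by Cauchy-Schwarz at least x²/pᵏ pairs of elements
-- have the same value at such a root.  Hence p has multiplicity at least
-- the sum over k of d (x²/pᵏ - x) in W, and comparing with the bound for W
-- gives the claim.

open import Defs
open import Algebra.Bundles using (CommutativeRing; RawRing)
import Algebra.Solver.Ring
open import Algebra.Solver.Ring.AlmostCommutativeRing
  using (fromCommutativeRing; _-Raw-AlmostCommutative⟶_)
open import Algebra.Structures using (IsCommutativeRing)
open import Data.Integer as ℤ using (ℤ; 0ℤ; 1ℤ; -1ℤ) renaming (+_ to pos; ∣_∣ to abs)
import Data.Integer.Divisibility.Signed as ℤ∣
open import Data.Integer.DivMod using (_%ℕ_; _/ℕ_; n%ℕd<d; a≡a%ℕn+[a/ℕn]*n)
import Data.Integer.Properties as ℤ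
import Data.Integer.Tactic.RingSolver as ℤSolver
open import Data.List using (List; []; _∷_; upTo)
open import Data.List.Membership.Propositional.Properties using (∈-filter⁺; ∈-upTo⁺)
open import Data.List.Relation.Unary.All using (All; []; _∷_; map)
open import Data.List.Relation.Unary.All.Properties using (all-filter)
import Data.Maybe.Base as Maybe
open import Data.Nat
open import Data.Nat.Divisibility
open import Data.Nat.DivMod
  using (_/_; _%_; m≡m%n+[m/n]*n; m%n<n; m<n*o⇒m/o<n; m/n*n≤m; m<n⇒m/n≡0)
open import Data.Nat.ListAction using (product)
open import Data.Nat.ListAction.Properties using (∈⇒∣product)
open import Data.Nat.Primality
open import Data.Nat.Primality.Factorisation using (PrimeFactorisation; factorise)
open import Data.Nat.Properties
open import Data.Nat.Tactic.RingSolver using (solve-∀)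
open import Data.Product using (_×_; _,_; proj₁; proj₂; ∃-syntax; Σ-syntax)
open import Data.Sum using (_⊎_; inj₁; inj₂)
open import Function using (_∘_; id)
open import Level using (0ℓ)
open import Relation.Binary.Bundles using (Setoid)
open import Relation.Binary.Definitions using (WeaklyDecidable)
open import Relation.Binary.PropositionalEquality
  using (_≡_; _≢_; refl; sym; trans; cong; cong₂; subst; subst₂; module ≡-Reasoning; isEquivalence)
import Relation.Binary.Reasoning.Setoid
open import Relation.Nullary using (¬_; Dec; yes; no; contradiction)
open import Relation.Nullary.Decidable using (dec⇒maybe; _×-dec_)

-- Finite sums and products

-- No logarithm occurs: every estimate is a divisibility or an inequality between natural numbers,
-- and the exponent x² clears the denominators that come from averaging over pairs. After extracting
-- an x²-th root, W contributes only (C x)^N, which is N^N up to a factor exponential in N. This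
-- single N^N is what lowers the leading coefficient from d to d - 1. The condition p ≡ 1 mod 2d is
-- never tested. A prime dividing P supplies a root of f modulo p, and everything that is needed
-- about p follows from this root. W must not vanish, so a nonzero element of the ring must have
-- nonzero norm. This is where the irreducibility of X^d + 1 enters, in the form of a descent at the
-- prime 2. The size x is a power of 2^d between 2N and 2^(d+1) N: a d-th power, so that the box has
-- exactly x elements, and a power of 2, so that a common multiple of 1, ..., x can be built by
-- doubling. Odd primes are accordingly separated at x rather than at 2N.

∑ ∏ : ℕ → (ℕ → ℕ) → ℕ
∑ zero    f = 0
∑ (suc n) f = ∑ n f + f n
∏ zero    f = 1
∏ (suc n) f = ∏ n f * f n

infix 10 ∑ ∏
syntax ∑ n (λ i → e) = ∑[ i < n ] e
syntax ∏ n (λ i → e) = ∏[ i < n ] e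

∑-mono : ∀ n {f g} → (∀ i → i < n → f i ≤ g i) → ∑ n f ≤ ∑ n g
∑-mono zero    h = z≤n
∑-mono (suc n) h = +-mono-≤ (∑-mono n λ i i<n → h i (m<n⇒m<1+n i<n)) (h n ≤-refl)

∑-cong : ∀ n {f g} → (∀ i → i < n → f i ≡ g i) → ∑ n f ≡ ∑ n g
∑-cong zero    h = refl
∑-cong (suc n) h = cong₂ _+_ (∑-cong n λ i i<n → h i (m<n⇒m<1+n i<n)) (h n ≤-refl)

∑-const : ∀ n c → ∑[ i < n ] c ≡ n * c
∑-const zero    c = refl
∑-const (suc n) c = trans (cong (_+ c) (∑-const n c)) (+-comm (n * c) c)

∑-≤-const : ∀ n {f} c → (∀ i → i < n → f i ≤ c) → ∑ n f ≤ n * c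
∑-≤-const n c h = ≤-trans (∑-mono n h) (≤-reflexive (∑-const n c))

∑-distrib-+ : ∀ n f g → ∑[ i < n ] (f i + g i) ≡ ∑ n f + ∑ n g
∑-distrib-+ zero    f g = refl
∑-distrib-+ (suc n) f g = trans (cong (_+ (f n + g n)) (∑-distrib-+ n f g))
  (interchange (∑ n f) (∑ n g) (f n) (g n))
  where
  interchange : ∀ a b c d → (a + b) + (c + d) ≡ (a + c) + (b + d)
  interchange = solve-∀

*-distribˡ-∑ : ∀ c n f → c * ∑ n f ≡ ∑[ i < n ] (c * f i)
*-distribˡ-∑ c zero    f = *-zeroʳ c
*-distribˡ-∑ c (suc n) f =
  trans (*-distribˡ-+ c (∑ n f) (f n)) (cong (_+ c * f n) (*-distribˡ-∑ c n f))

*-distribʳ-∑ : ∀ c n f → ∑ n f * c ≡ ∑[ i < n ] (f i * c)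
*-distribʳ-∑ c zero    f = refl
*-distribʳ-∑ c (suc n) f =
  trans (*-distribʳ-+ c (∑ n f) (f n)) (cong (_+ f n * c) (*-distribʳ-∑ c n f))

∑-comm : ∀ m n (f : ℕ → ℕ → ℕ) →
  ∑[ i < m ] (∑[ j < n ] f i j) ≡ ∑[ j < n ] (∑[ i < m ] f i j)
∑-comm zero    n f = sym (trans (∑-const n 0) (*-zeroʳ n))
∑-comm (suc m) n f = trans (cong (_+ ∑ n (f m)) (∑-comm m n f))
  (sym (∑-distrib-+ n (λ j → ∑[ i < m ] f i j) (f m)))

∑-split : ∀ m n f → ∑ (m + n) f ≡ ∑ m f + ∑[ i < n ] f (m + i)
∑-split m zero    f = trans (cong (λ k → ∑ k f) (+-identityʳ m)) (sym (+-identityʳ _))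
∑-split m (suc n) f = trans (cong (λ k → ∑ k f) (+-suc m n))
  (trans (cong (_+ f (m + n)) (∑-split m n f)) (+-assoc (∑ m f) _ _))

∑-≤-extend : ∀ {m n} f → m ≤ n → ∑ m f ≤ ∑ n f
∑-≤-extend {m} {n} f m≤n = ≤-trans (m≤m+n (∑ m f) _)
  (≤-reflexive (trans (sym (∑-split m (n ∸ m) f)) (cong (λ k → ∑ k f) (m+[n∸m]≡n m≤n))))

term≤∑ : ∀ {n i} f → i < n → f i ≤ ∑ n f
term≤∑ {suc n} {i} f i<1+n = ≤-trans (m≤n+m (f i) (∑ i f)) (∑-≤-extend f i<1+n)

∏-mono : ∀ n {f g} → (∀ i → i < n → f i ≤ g i) → ∏ n f ≤ ∏ n g
∏-mono zero    h = ≤-refl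
∏-mono (suc n) h = *-mono-≤ (∏-mono n λ i i<n → h i (m<n⇒m<1+n i<n)) (h n ≤-refl)

∏-const : ∀ n c → ∏[ i < n ] c ≡ c ^ n
∏-const zero    c = refl
∏-const (suc n) c = trans (cong (_* c) (∏-const n c)) (*-comm (c ^ n) c)

∏-≢0 : ∀ n {f} → (∀ i → i < n → NonZero (f i)) → NonZero (∏ n f)
∏-≢0 zero    h = _
∏-≢0 (suc n) h =
  m*n≢0 _ _ {{∏-≢0 n λ i i<n → h i (m<n⇒m<1+n i<n)}} {{h n ≤-refl}}

^∑∣∏ : ∀ b n (e f : ℕ → ℕ) → (∀ i → i < n → b ^ e i ∣ f i) → b ^ ∑ n e ∣ ∏ n f
^∑∣∏ b zero    e f h = ∣-refl
^∑∣∏ b (suc n) e f h = subst (_∣ ∏ n f * f n) (sym (^-distribˡ-+-* b (∑ n e) (e n)))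
  (*-pres-∣ (^∑∣∏ b n e f λ i i<n → h i (m<n⇒m<1+n i<n)) (h n ≤-refl))

^-distribʳ-* : ∀ m n o → (m * n) ^ o ≡ m ^ o * n ^ o
^-distribʳ-* m n zero    = refl
^-distribʳ-* m n (suc o) = trans (cong (m * n *_) (^-distribʳ-* m n o)) (lemma m n (m ^ o) (n ^ o))
  where
  lemma : ∀ a b c d → a * b * (c * d) ≡ a * c * (b * d)
  lemma = solve-∀

^-cancelˡ-≤ : ∀ n .{{_ : NonZero n}} {a b} → a ^ n ≤ b ^ n → a ≤ b
^-cancelˡ-≤ n {a} {b} le with a ≤? b
... | yes a≤b = a≤b
... | no  a≰b = contradiction le (<⇒≱ (^-monoˡ-< n (≰⇒> a≰b)))

-- Indicators and counting

𝟙 : ∀ {a} {P : Set a} → Dec P → ℕ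
𝟙 (yes _) = 1
𝟙 (no  _) = 0

𝟙-mono : ∀ {a b} {P : Set a} {Q : Set b} (P? : Dec P) (Q? : Dec Q) → (P → Q) → 𝟙 P? ≤ 𝟙 Q?
𝟙-mono (no _)  Q?      P⇒Q = z≤n
𝟙-mono (yes p) (yes _) P⇒Q = ≤-refl
𝟙-mono (yes p) (no ¬q) P⇒Q = contradiction (P⇒Q p) ¬q

𝟙-yes : ∀ {a} {P : Set a} (P? : Dec P) → P → 𝟙 P? ≡ 1
𝟙-yes (yes _) p = refl
𝟙-yes (no ¬p) p = contradiction p ¬p

𝟙-no : ∀ {a} {P : Set a} (P? : Dec P) → ¬ P → 𝟙 P? ≡ 0
𝟙-no (yes p) ¬p = contradiction p ¬p
𝟙-no (no _)  ¬p = refl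

𝟙≤1 : ∀ {a} {P : Set a} (P? : Dec P) → 𝟙 P? ≤ 1
𝟙≤1 (yes _) = ≤-refl
𝟙≤1 (no _)  = z≤n

count≡0 : ∀ {P : ℕ → Set} (P? : ∀ i → Dec (P i)) n → (∀ i → i < n → ¬ P i) →
  ∑[ i < n ] 𝟙 (P? i) ≡ 0
count≡0 P? n none = trans (∑-cong n λ i i<n → 𝟙-no (P? i) (none i i<n))
  (trans (∑-const n 0) (*-zeroʳ n))

count≤1 : ∀ {P : ℕ → Set} (P? : ∀ i → Dec (P i)) n →
  (∀ i j → i < n → j < n → P i → P j → i ≡ j) → ∑[ i < n ] 𝟙 (P? i) ≤ 1
count≤1 P? zero    uniq = z≤n
count≤1 P? (suc n) uniq with P? n
... | no _  = ≤-trans (≤-reflexive (+-identityʳ _))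
  (count≤1 P? n λ i j i<n j<n → uniq i j (m<n⇒m<1+n i<n) (m<n⇒m<1+n j<n))
... | yes p = ≤-reflexive (cong (_+ 1) (count≡0 P? n λ i i<n q →
  <⇒≢ i<n (uniq i n (m<n⇒m<1+n i<n) ≤-refl q p)))

-- Union bound by double counting. The labels will be the roots of a polynomial modulo a prime
-- power.
count≤labels : ∀ {P : ℕ → Set} {Q : ℕ → ℕ → Set}
  (P? : ∀ i → Dec (P i)) (Q? : ∀ i j → Dec (Q i j)) n m b →
  (∀ i → i < n → P i → ∃[ j ] (j < m × Q i j)) →
  (∀ j → j < m → ∑[ i < n ] 𝟙 (Q? i j) ≤ b) →
  ∑[ i < n ] 𝟙 (P? i) ≤ m * b
count≤labels P? Q? n m b label bound = begin
  ∑[ i < n ] 𝟙 (P? i)                  ≤⟨ ∑-mono n labelled ⟩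
  ∑[ i < n ] (∑[ j < m ] 𝟙 (Q? i j))   ≡⟨ ∑-comm n m (λ i j → 𝟙 (Q? i j)) ⟩
  ∑[ j < m ] (∑[ i < n ] 𝟙 (Q? i j))   ≤⟨ ∑-≤-const m b bound ⟩
  m * b                                ∎
  where
  open ≤-Reasoning
  labelled : ∀ i → i < n → 𝟙 (P? i) ≤ ∑[ j < m ] 𝟙 (Q? i j)
  labelled i i<n with P? i
  ... | no _  = z≤n
  ... | yes p with j , j<m , q ← label i i<n p =
    ≤-trans (≤-reflexive (sym (𝟙-yes (Q? i j) q))) (term≤∑ (λ j → 𝟙 (Q? i j)) j<m)

2ab≤a²+b² : ∀ a b → 2 * (a * b) ≤ a * a + b * b
2ab≤a²+b² a b with ≤-total a b
... | inj₁ a≤b = subst (λ c → 2 * (a * c) ≤ a * a + c * c) (m+[n∸m]≡n a≤b)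
  (≤-trans (m≤m+n _ ((b ∸ a) * (b ∸ a))) (≤-reflexive (square a (b ∸ a))))
  where
  square : ∀ a c → 2 * (a * (a + c)) + c * c ≡ a * a + (a + c) * (a + c)
  square = solve-∀
... | inj₂ b≤a = subst (λ c → 2 * (c * b) ≤ c * c + b * b) (m+[n∸m]≡n b≤a)
  (≤-trans (m≤m+n _ ((a ∸ b) * (a ∸ b))) (≤-reflexive (square b (a ∸ b))))
  where
  square : ∀ b c → 2 * ((b + c) * b) + c * c ≡ (b + c) * (b + c) + b * b
  square = solve-∀

-- Induction on `n`: each of the new cross terms 2 f(i) a is at most f(i)² + a².
cauchy-schwarz : ∀ n f → ∑ n f * ∑ n f ≤ n * ∑[ i < n ] (f i * f i)
cauchy-schwarz zero    f = z≤n
cauchy-schwarz (suc n) f = begin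
  (s + a) * (s + a)                             ≡⟨ expand s a ⟩
  s * s + s * (2 * a) + a * a                   ≤⟨ +-monoˡ-≤ (a * a) (+-mono-≤ (cauchy-schwarz n f) cross) ⟩
  n * S + (S + n * (a * a)) + a * a             ≡⟨ collect n S (a * a) ⟩
  suc n * (S + a * a)                           ∎
  where
  open ≤-Reasoning
  s = ∑ n f
  a = f n
  S = ∑[ i < n ] (f i * f i)
  expand : ∀ s a → (s + a) * (s + a) ≡ s * s + s * (2 * a) + a * a
  expand = solve-∀
  collect : ∀ n S b → n * S + (S + n * b) + b ≡ suc n * (S + b)
  collect = solve-∀
  move : ∀ b a → b * (2 * a) ≡ 2 * (b * a)
  move = solve-∀
  cross : s * (2 * a) ≤ S + n * (a * a)
  cross = begin
    s * (2 * a)                        ≡⟨ *-distribʳ-∑ (2 * a) n f ⟩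
    ∑[ i < n ] (f i * (2 * a))         ≤⟨ ∑-mono n (λ i _ → ≤-trans (≤-reflexive (move (f i) a)) (2ab≤a²+b² (f i) a)) ⟩
    ∑[ i < n ] (f i * f i + a * a)     ≡⟨ ∑-distrib-+ n (λ i → f i * f i) (λ _ → a * a) ⟩
    S + ∑[ i < n ] (a * a)             ≡⟨ cong (S +_) (∑-const n (a * a)) ⟩
    S + n * (a * a)                    ∎

∑-square : ∀ n f → ∑ n f * ∑ n f ≡ ∑[ i < n ] (∑[ j < n ] (f i * f j))
∑-square n f = trans (*-distribʳ-∑ (∑ n f) n f) (∑-cong n λ i _ → *-distribˡ-∑ (f i) n f)

-- The fibres of `c` have total size n, and the sum of their squared sizes is the number of ordered
-- pairs with equal value. The pairs with i = j are included; their share has to be removed later.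
collisions : ∀ n q (c : ℕ → ℕ) → (∀ i → i < n → c i < q) →
  n * n ≤ q * ∑[ i < n ] (∑[ j < n ] 𝟙 (c i ≟ c j))
collisions n q c c<q = begin
  n * n                                             ≡⟨ cong₂ _*_ total total ⟩
  ∑ q fibre * ∑ q fibre                             ≤⟨ cauchy-schwarz q fibre ⟩
  q * ∑[ r < q ] (fibre r * fibre r)                ≤⟨ *-monoʳ-≤ q squares ⟩
  q * ∑[ i < n ] (∑[ j < n ] 𝟙 (c i ≟ c j))         ∎
  where
  open ≤-Reasoning
  fibre : ℕ → ℕ
  fibre r = ∑[ i < n ] 𝟙 (c i ≟ r)
  one-class : ∀ i → i < n → ∑[ r < q ] 𝟙 (c i ≟ r) ≡ 1
  one-class i i<n = ≤-antisym (count≤1 (c i ≟_) q λ _ _ _ _ e e′ → trans (sym e) e′)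
    (≤-trans (≤-reflexive (sym (𝟙-yes (c i ≟ c i) refl))) (term≤∑ (λ r → 𝟙 (c i ≟ r)) (c<q i i<n)))
  total : n ≡ ∑ q fibre
  total = sym (trans (∑-comm q n λ r i → 𝟙 (c i ≟ r))
    (trans (∑-cong n one-class) (trans (∑-const n 1) (*-identityʳ n))))
  same-class : ∀ i j → i < n → ∑[ r < q ] (𝟙 (c i ≟ r) * 𝟙 (c j ≟ r)) ≤ 𝟙 (c i ≟ c j)
  same-class i j i<n with c i ≟ c j
  ... | yes _ = ≤-trans
    (∑-mono q λ r _ → ≤-trans (*-monoʳ-≤ (𝟙 (c i ≟ r)) (𝟙≤1 (c j ≟ r))) (≤-reflexive (*-identityʳ _)))
    (≤-reflexive (one-class i i<n))
  ... | no ci≢cj = ≤-reflexive (trans (∑-cong q disjoint) (trans (∑-const q 0) (*-zeroʳ q)))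
    where
    disjoint : ∀ r → r < q → 𝟙 (c i ≟ r) * 𝟙 (c j ≟ r) ≡ 0
    disjoint r _ with c i ≟ r
    ... | no _     = refl
    ... | yes refl = trans (+-identityʳ _) (𝟙-no (c j ≟ c i) (ci≢cj ∘ sym))
  squares : ∑[ r < q ] (fibre r * fibre r) ≤ ∑[ i < n ] (∑[ j < n ] 𝟙 (c i ≟ c j))
  squares = begin
    ∑[ r < q ] (fibre r * fibre r)
      ≡⟨ ∑-cong q (λ r _ → ∑-square n (λ i → 𝟙 (c i ≟ r))) ⟩
    ∑[ r < q ] (∑[ i < n ] (∑[ j < n ] (𝟙 (c i ≟ r) * 𝟙 (c j ≟ r))))
      ≡⟨ ∑-comm q n (λ r i → ∑[ j < n ] (𝟙 (c i ≟ r) * 𝟙 (c j ≟ r))) ⟩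
    ∑[ i < n ] (∑[ r < q ] (∑[ j < n ] (𝟙 (c i ≟ r) * 𝟙 (c j ≟ r))))
      ≡⟨ ∑-cong n (λ i _ → ∑-comm q n (λ r j → 𝟙 (c i ≟ r) * 𝟙 (c j ≟ r))) ⟩
    ∑[ i < n ] (∑[ j < n ] (∑[ r < q ] (𝟙 (c i ≟ r) * 𝟙 (c j ≟ r))))
      ≤⟨ ∑-mono n (λ i i<n → ∑-mono n λ j _ → same-class i j i<n) ⟩
    ∑[ i < n ] (∑[ j < n ] 𝟙 (c i ≟ c j)) ∎

-- Multiplicities of primes

prime⇒1< : ∀ {p} → Prime p → 1 < p
prime⇒1< pr = nonTrivial⇒n>1 _ {{prime⇒nonTrivial pr}}

prime⇒^≢0 : ∀ {p} → Prime p → ∀ k → NonZero (p ^ k)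
prime⇒^≢0 {p} pr k = m^n≢0 p k {{prime⇒nonZero pr}}

∣1⇒¬prime : ∀ {p} → Prime p → ¬ (p ∣ 1)
∣1⇒¬prime pr p∣1 = <⇒≢ (prime⇒1< pr) (sym (∣1⇒≡1 p∣1))

prime∣^⇒∣ : ∀ {p} → Prime p → ∀ m k → p ∣ m ^ k → p ∣ m
prime∣^⇒∣ pr m zero    p∣1 = contradiction p∣1 (∣1⇒¬prime pr)
prime∣^⇒∣ pr m (suc k) p∣ with euclidsLemma m (m ^ k) pr p∣
... | inj₁ p∣m  = p∣m
... | inj₂ p∣mᵏ = prime∣^⇒∣ pr m k p∣mᵏ

prime∣∏⇒∣ : ∀ {p} → Prime p → ∀ n f → p ∣ ∏ n f → ∃[ i ] (i < n × p ∣ f i)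
prime∣∏⇒∣ pr zero    f p∣1 = contradiction p∣1 (∣1⇒¬prime pr)
prime∣∏⇒∣ pr (suc n) f p∣ with euclidsLemma (∏ n f) (f n) pr p∣
... | inj₂ p∣fn = n , ≤-refl , p∣fn
... | inj₁ p∣∏ with i , i<n , p∣fi ← prime∣∏⇒∣ pr n f p∣∏ = i , m<n⇒m<1+n i<n , p∣fi

^-monoʳ-∣ : ∀ p {m n} → m ≤ n → p ^ m ∣ p ^ n
^-monoʳ-∣ p {m} {n} m≤n = subst (p ^ m ∣_)
  (trans (sym (^-distribˡ-+-* p m (n ∸ m))) (cong (p ^_) (m+[n∸m]≡n m≤n))) (m∣m*n _)

^-monoˡ-∣ : ∀ k {m n} → m ∣ n → m ^ k ∣ n ^ k
^-monoˡ-∣ zero    m∣n = ∣-refl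
^-monoˡ-∣ (suc k) m∣n = *-pres-∣ m∣n (^-monoˡ-∣ k m∣n)

-- When the exponent grows by one, cancelling the powers already split off leaves p dividing the
-- product of the two cofactors, and one of them takes the new factor.
prime-power-split : ∀ {p} → Prime p → ∀ k m n → p ^ k ∣ m * n →
  ∃[ i ] ∃[ j ] (i + j ≡ k × p ^ i ∣ m × p ^ j ∣ n)
prime-power-split pr zero m n _ = 0 , 0 , refl , 1∣ m , 1∣ n
prime-power-split {p} pr (suc k) m n p¹⁺ᵏ∣mn
  with prime-power-split pr k m n (∣-trans (^-monoʳ-∣ p (n≤1+n k)) p¹⁺ᵏ∣mn)
... | i , j , refl , divides m′ refl , divides n′ refl
  with euclidsLemma m′ n′ pr p∣m′n′
  where
  regroup : ∀ a b c d → a * b * (c * d) ≡ b * d * (a * c)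
  regroup = solve-∀
  p∣m′n′ : p ∣ m′ * n′
  p∣m′n′ = *-cancelˡ-∣ (p ^ (i + j)) {{prime⇒^≢0 pr (i + j)}}
    (subst₂ _∣_ (*-comm p (p ^ (i + j)))
      (trans (regroup m′ (p ^ i) n′ (p ^ j)) (cong (_* (m′ * n′)) (sym (^-distribˡ-+-* p i j))))
      p¹⁺ᵏ∣mn)
... | inj₁ p∣m′ = suc i , j , refl , *-monoˡ-∣ (p ^ i) p∣m′ , n∣m*n n′
... | inj₂ p∣n′ = i , suc j , +-suc i j , n∣m*n m′ , *-monoˡ-∣ (p ^ j) p∣n′

prime-power-∣⊎∣ : ∀ {p} → Prime p → ∀ k m n → ¬ (p ∣ m × p ∣ n) → p ^ k ∣ m * n →
  p ^ k ∣ m ⊎ p ^ k ∣ n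
prime-power-∣⊎∣ {p} pr k m n ¬both pᵏ∣mn with prime-power-split pr k m n pᵏ∣mn
... | zero  , j     , refl , _    , pʲ∣n = inj₂ pʲ∣n
... | suc i , zero  , refl , pⁱ∣m , _    = inj₁ (subst (λ k → p ^ k ∣ m) (sym (+-identityʳ (suc i))) pⁱ∣m)
... | suc i , suc j , refl , pⁱ∣m , pʲ∣n =
  contradiction (m*n∣⇒m∣ p (p ^ i) pⁱ∣m , m*n∣⇒m∣ p (p ^ j) pʲ∣n) ¬both

-- An upper bound for the p-adic valuation, expressed by divisibility alone so that no valuation
-- function has to be defined.
MultiplicityAtMost : ℕ → ℕ → ℕ → Set
MultiplicityAtMost p e m = ∀ k → p ^ k ∣ m → k ≤ e

multiplicity-weaken : ∀ {p e e′ m} → e ≤ e′ → MultiplicityAtMost p e m → MultiplicityAtMost p e′ m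
multiplicity-weaken e≤e′ h k pᵏ∣m = ≤-trans (h k pᵏ∣m) e≤e′

multiplicity-∤ : ∀ {p m} → ¬ (p ∣ m) → MultiplicityAtMost p 0 m
multiplicity-∤ p∤m zero    _    = z≤n
multiplicity-∤ p∤m (suc k) pᵏ∣m = contradiction (m*n∣⇒m∣ _ _ pᵏ∣m) p∤m

multiplicity-* : ∀ {p} → Prime p → ∀ {d e m n} → MultiplicityAtMost p d m →
  MultiplicityAtMost p e n → MultiplicityAtMost p (d + e) (m * n)
multiplicity-* pr {m = m} {n} hm hn k pᵏ∣mn with prime-power-split pr k m n pᵏ∣mn
... | i , j , refl , pⁱ∣m , pʲ∣n = +-mono-≤ (hm i pⁱ∣m) (hn j pʲ∣n)

multiplicity-∏ : ∀ {p} → Prime p → ∀ n {e f : ℕ → ℕ} →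
  (∀ i → i < n → MultiplicityAtMost p (e i) (f i)) → MultiplicityAtMost p (∑ n e) (∏ n f)
multiplicity-∏ pr zero    h = multiplicity-∤ (∣1⇒¬prime pr)
multiplicity-∏ pr (suc n) h =
  multiplicity-* pr (multiplicity-∏ pr n λ i i<n → h i (m<n⇒m<1+n i<n)) (h n ≤-refl)

multiplicity-^ : ∀ {p} → Prime p → ∀ n {e m} → MultiplicityAtMost p e m →
  MultiplicityAtMost p (n * e) (m ^ n)
multiplicity-^ pr n {e} {m} h = subst₂ (MultiplicityAtMost _) (∑-const n e) (∏-const n m)
  (multiplicity-∏ pr n {λ _ → e} {λ _ → m} λ _ _ → h)

-- For a prime p this is the p-adic valuation of m truncated at `K`. The truncation keeps it
-- meaningful for m = 0, which occurs among values of polynomials.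
powersDividing : ℕ → ℕ → ℕ → ℕ
powersDividing p K m = ∑[ k < K ] 𝟙 (p ^ suc k ∣? m)

multiplicity≤powersDividing : ∀ p K m → ¬ (p ^ suc K ∣ m) →
  MultiplicityAtMost p (powersDividing p K m) m
multiplicity≤powersDividing p K m p∤ k pᵏ∣m with k ≤? K
... | no k≰K  = contradiction (∣-trans (^-monoʳ-∣ p (≰⇒> k≰K)) pᵏ∣m) p∤
... | yes k≤K = begin
  k                                   ≡⟨ sym (trans (∑-const k 1) (*-identityʳ k)) ⟩
  ∑[ j < k ] 1                        ≤⟨ ∑-mono k (λ j j<k → ≤-reflexive (sym (𝟙-yes (p ^ suc j ∣? m) (∣-trans (^-monoʳ-∣ p j<k) pᵏ∣m)))) ⟩
  powersDividing p k m                ≤⟨ ∑-≤-extend (λ j → 𝟙 (p ^ suc j ∣? m)) k≤K ⟩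
  powersDividing p K m                ∎
  where open ≤-Reasoning

^powersDividing∣ : ∀ p K m → p ^ powersDividing p K m ∣ m
^powersDividing∣ p zero    m = 1∣ m
^powersDividing∣ p (suc K) m with p ^ suc K ∣? m
... | no _  = subst (λ e → p ^ e ∣ m) (sym (+-identityʳ (powersDividing p K m))) (^powersDividing∣ p K m)
... | yes d = ∣-trans (^-monoʳ-∣ p bound) d
  where
  bound : powersDividing p K m + 1 ≤ suc K
  bound = ≤-trans (+-monoˡ-≤ 1 (≤-trans (∑-≤-const K 1 λ k _ → 𝟙≤1 (p ^ suc k ∣? m)) (≤-reflexive (*-identityʳ K))))
    (≤-reflexive (+-comm K 1))

-- The head p can be cancelled on both sides without losing the local hypothesis: at q = p one power
-- of p disappears from each side, and at q ≠ p the factor p of `b` contributes no power of q.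
product∣-local : ∀ {ps} → All Prime ps → ∀ b →
  (∀ q → Prime q → ∀ k → q ^ k ∣ product ps → q ^ k ∣ b) → product ps ∣ b
product∣-local {[]}     []         b h = 1∣ b
product∣-local {p ∷ ps} (pr ∷ prs) b h
  with divides b′ refl ← subst (_∣ b) (*-identityʳ p)
    (h p pr 1 (subst (_∣ p * product ps) (sym (*-identityʳ p)) (m∣m*n (product ps))))
  = subst (_∣ b′ * p) (*-comm (product ps) p) (*-monoˡ-∣ p (product∣-local prs b′ local))
  where
  local : ∀ q → Prime q → ∀ k → q ^ k ∣ product ps → q ^ k ∣ b′
  local q qr k qᵏ∣ with q ≟ p
  ... | yes refl = *-cancelˡ-∣ p {{prime⇒nonZero pr}}
    (subst (p ^ suc k ∣_) (*-comm b′ p) (h p pr (suc k) (*-monoʳ-∣ p qᵏ∣)))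
  ... | no q≢p with prime-power-split qr k b′ p (h q qr k (∣n⇒∣m*n p qᵏ∣))
  ...   | i , zero  , refl , qⁱ∣b′ , _ = subst (λ k → q ^ k ∣ b′) (sym (+-identityʳ i)) qⁱ∣b′
  ...   | i , suc j , refl , _ , q∣p with prime⇒irreducible pr (m*n∣⇒m∣ q (q ^ j) q∣p)
  ...     | inj₁ q≡1 = contradiction (subst (_∣ 1) (sym q≡1) ∣-refl) (∣1⇒¬prime qr)
  ...     | inj₂ q≡p = contradiction q≡p q≢p

∣-local : ∀ a b .{{_ : NonZero a}} → (∀ q → Prime q → ∀ k → q ^ k ∣ a → q ^ k ∣ b) → a ∣ b
∣-local a b h = subst (_∣ b) (sym isFactorisation)
  (product∣-local factorsPrime b λ q qr k → h q qr k ∘ subst (q ^ k ∣_) (sym isFactorisation))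
  where open PrimeFactorisation (factorise a)

-- A multiple of 1, …, 2ⁱ which is at most exponential in 2ⁱ

-- The binomial coefficient (a + b)! / (a! b!). With this symmetric indexing Pascal's rule involves
-- no subtraction and no vanishing boundary values.
binom : ℕ → ℕ → ℕ
binom zero    b       = 1
binom (suc a) zero    = 1
binom (suc a) (suc b) = binom a (suc b) + binom (suc a) b

binom-! : ∀ a b → binom a b * (a ! * b !) ≡ (a + b) !
binom-! zero    b = trans (*-identityˡ _) (*-identityˡ (b !))
binom-! (suc a) zero = trans (*-identityˡ _)
  (trans (*-identityʳ _) (cong _! (sym (+-identityʳ (suc a)))))
binom-! (suc a) (suc b) = begin
  (binom a (suc b) + binom (suc a) b) * (suc a * a ! * (suc b * b !))
    ≡⟨ regroup (binom a (suc b)) (binom (suc a) b) (suc a) (a !) (suc b) (b !) ⟩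
  suc a * (binom a (suc b) * (a ! * (suc b * b !))) + suc b * (binom (suc a) b * (suc a * a ! * b !))
    ≡⟨ cong₂ (λ u v → suc a * u + suc b * v) (binom-! a (suc b)) (binom-! (suc a) b) ⟩
  suc a * (a + suc b) ! + suc b * (suc a + b) !
    ≡⟨ cong (λ n → suc a * (n !) + suc b * (suc a + b) !) (+-suc a b) ⟩
  suc a * (suc a + b) ! + suc b * (suc a + b) !
    ≡⟨ sym (*-distribʳ-+ ((suc a + b) !) (suc a) (suc b)) ⟩
  (suc a + suc b) * (suc a + b) !
    ≡⟨ cong (λ n → (suc a + suc b) * n !) (sym (+-suc a b)) ⟩
  (suc a + suc b) ! ∎
  where
  open ≡-Reasoning
  regroup : ∀ x y s u t v → (x + y) * (s * u * (t * v)) ≡ s * (x * (u * (t * v))) + t * (y * (s * u * v))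
  regroup = solve-∀

binom≤2^ : ∀ a b → binom a b ≤ 2 ^ (a + b)
binom≤2^ zero    b       = m^n>0 2 b
binom≤2^ (suc a) zero    = m^n>0 2 (suc a + 0)
binom≤2^ (suc a) (suc b) = begin
  binom a (suc b) + binom (suc a) b          ≤⟨ +-mono-≤ (binom≤2^ a (suc b)) (binom≤2^ (suc a) b) ⟩
  2 ^ (a + suc b) + 2 ^ (suc a + b)          ≡⟨ cong (λ n → 2 ^ (a + suc b) + 2 ^ n) (sym (+-suc a b)) ⟩
  2 ^ (a + suc b) + 2 ^ (a + suc b)          ≡⟨ cong (2 ^ (a + suc b) +_) (sym (+-identityʳ _)) ⟩
  2 ^ (suc a + suc b)                        ∎
  where open ≤-Reasoning

binom≢0 : ∀ a b → NonZero (binom a b)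
binom≢0 zero    b       = _
binom≢0 (suc a) zero    = _
binom≢0 (suc a) (suc b) = >-nonZero (≤-trans (>-nonZero⁻¹ _ {{binom≢0 a (suc b)}}) (m≤m+n _ _))

binom-absorb : ∀ a b → suc a * binom (suc a) b ≡ (suc a + b) * binom a b
binom-absorb a b = *-cancelʳ-≡ _ _ (a ! * b !) {{m*n≢0 (a !) (b !) {{>-nonZero (1≤n! a)}} {{>-nonZero (1≤n! b)}}}} (begin
  suc a * binom (suc a) b * (a ! * b !)       ≡⟨ regroup (suc a) (binom (suc a) b) (a !) (b !) ⟩
  binom (suc a) b * (suc a * a ! * b !)       ≡⟨ binom-! (suc a) b ⟩
  (suc a + b) * (a + b) !                     ≡⟨ cong ((suc a + b) *_) (sym (binom-! a b)) ⟩
  (suc a + b) * (binom a b * (a ! * b !))     ≡⟨ sym (*-assoc (suc a + b) (binom a b) _) ⟩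
  (suc a + b) * binom a b * (a ! * b !)       ∎)
  where
  open ≡-Reasoning
  regroup : ∀ s x u v → s * x * (u * v) ≡ x * (s * u * v)
  regroup = solve-∀

binom-absorbʳ : ∀ a b → suc b * binom a (suc b) ≡ (suc a + b) * binom a b
binom-absorbʳ a b = *-cancelʳ-≡ _ _ (a ! * b !) {{m*n≢0 (a !) (b !) {{>-nonZero (1≤n! a)}} {{>-nonZero (1≤n! b)}}}} (begin
  suc b * binom a (suc b) * (a ! * b !)       ≡⟨ regroup (suc b) (binom a (suc b)) (a !) (b !) ⟩
  binom a (suc b) * (a ! * (suc b * b !))     ≡⟨ binom-! a (suc b) ⟩
  (a + suc b) !                               ≡⟨ cong _! (+-suc a b) ⟩
  (suc a + b) * (a + b) !                     ≡⟨ cong ((suc a + b) *_) (sym (binom-! a b)) ⟩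
  (suc a + b) * (binom a b * (a ! * b !))     ≡⟨ sym (*-assoc (suc a + b) (binom a b) _) ⟩
  (suc a + b) * binom a b * (a ! * b !)       ∎)
  where
  open ≡-Reasoning
  regroup : ∀ s x u v → s * x * (u * v) ≡ x * (u * (s * v))
  regroup = solve-∀

-- Leibniz's harmonic triangle: with t(a,b) = (a+1) binom (a+1) b one has
-- 1/t(a,b) = 1/t(a,b+1) + 1/t(a+1,b), so multiples of the edge entries
-- t(0,b) = b + 1 are multiples of all entries.
leibniz∣ : ∀ n D → (∀ m → 1 ≤ m → m ≤ n → m ∣ D) →
  ∀ a b → suc a + b ≤ n → suc a * binom (suc a) b ∣ D
leibniz∣ n D h zero    b le = subst (_∣ D) (sym (trans (binom-absorb 0 b) (*-identityʳ (suc b)))) (h (suc b) (s≤s z≤n) le)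
leibniz∣ n D h (suc a) b le
  with divides u Du ← leibniz∣ n D h a b (≤-trans (n≤1+n _) le)
     | divides v Dv ← leibniz∣ n D h a (suc b) (subst (_≤ n) (cong suc (sym (+-suc a b))) le)
  = divides (u ∸ v) (*-cancelˡ-≡ _ _ (suc a) (begin
  suc a * D                                   ≡⟨ sym (m+n∸n≡m (suc a * D) (suc b * D)) ⟩
  suc a * D + suc b * D ∸ suc b * D           ≡⟨ cong₂ _∸_ left right ⟩
  u * (suc a * T) ∸ v * (suc a * T)           ≡⟨ sym (*-distribʳ-∸ (suc a * T) u v) ⟩
  (u ∸ v) * (suc a * T)                       ≡⟨ swap (u ∸ v) (suc a) T ⟩
  suc a * ((u ∸ v) * T)                       ∎))
  where
  open ≡-Reasoning
  T = suc (suc a) * binom (suc (suc a)) b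
  swap : ∀ x y z → x * (y * z) ≡ y * (x * z)
  swap = solve-∀
  swap₂ : ∀ x y z w → y * (x * (z * w)) ≡ x * (z * (y * w))
  swap₂ = solve-∀
  left : suc a * D + suc b * D ≡ u * (suc a * T)
  left = begin
    suc a * D + suc b * D                                       ≡⟨ sym (*-distribʳ-+ D (suc a) (suc b)) ⟩
    (suc a + suc b) * D                                         ≡⟨ cong₂ _*_ (cong suc (+-suc a b)) Du ⟩
    (suc (suc a) + b) * (u * (suc a * binom (suc a) b))         ≡⟨ swap₂ u (suc (suc a) + b) (suc a) (binom (suc a) b) ⟩
    u * (suc a * ((suc (suc a) + b) * binom (suc a) b))         ≡⟨ cong (λ t → u * (suc a * t)) (sym (binom-absorb (suc a) b)) ⟩
    u * (suc a * T)                                             ∎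
  right : suc b * D ≡ v * (suc a * T)
  right = begin
    suc b * D                                                   ≡⟨ cong (suc b *_) Dv ⟩
    suc b * (v * (suc a * binom (suc a) (suc b)))               ≡⟨ swap₂ v (suc b) (suc a) (binom (suc a) (suc b)) ⟩
    v * (suc a * (suc b * binom (suc a) (suc b)))               ≡⟨ cong (λ t → v * (suc a * t)) (binom-absorbʳ (suc a) b) ⟩
    v * (suc a * ((suc (suc a) + b) * binom (suc a) b))         ≡⟨ cong (λ t → v * (suc a * t)) (sym (binom-absorb (suc a) b)) ⟩
    v * (suc a * T)                                             ∎

-- Both sides are the multinomial coefficient (2n)! / (n! j! k!).
binom-revision : ∀ j k → let n = j + k in
  binom n n * binom j k ≡ binom (n + j) k * binom n j
binom-revision j k = *-cancelʳ-≡ _ _ (j ! * k ! * n !) {{nz}} (begin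
  binom n n * binom j k * (j ! * k ! * n !)           ≡⟨ regroup₁ (binom n n) (binom j k) (j !) (k !) (n !) ⟩
  binom n n * (binom j k * (j ! * k !) * n !)         ≡⟨ cong (λ t → binom n n * (t * n !)) (binom-! j k) ⟩
  binom n n * (n ! * n !)                             ≡⟨ binom-! n n ⟩
  (n + n) !                                           ≡⟨ cong _! (sym (+-assoc n j k)) ⟩
  (n + j + k) !                                       ≡⟨ sym (binom-! (n + j) k) ⟩
  binom (n + j) k * ((n + j) ! * k !)                 ≡⟨ cong (λ t → binom (n + j) k * (t * k !)) (sym (binom-! n j)) ⟩
  binom (n + j) k * (binom n j * (n ! * j !) * k !)   ≡⟨ regroup₂ (binom (n + j) k) (binom n j) (n !) (j !) (k !) ⟩
  binom (n + j) k * binom n j * (j ! * k ! * n !)     ∎)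
  where
  open ≡-Reasoning
  n = j + k
  nz : NonZero (j ! * k ! * n !)
  nz = m*n≢0 _ _ {{m*n≢0 (j !) (k !) {{>-nonZero (1≤n! j)}} {{>-nonZero (1≤n! k)}}}} {{>-nonZero (1≤n! n)}}
  regroup₁ : ∀ x y a b c → x * y * (a * b * c) ≡ x * (y * (a * b) * c)
  regroup₁ = solve-∀
  regroup₂ : ∀ x y c a b → x * (y * (c * a) * b) ≡ x * y * (a * b * c)
  regroup₂ = solve-∀

-- For m = n + (j + 1) and k = n - (j + 1), the Leibniz entry t(j,k) divides D, and its product with
-- the central binomial coefficient of 2n is a multiple of m.
multiples-double : ∀ n D → (∀ m → 1 ≤ m → m ≤ n → m ∣ D) →
  ∀ m → 1 ≤ m → m ≤ n + n → m ∣ D * binom n n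
multiples-double n D h m 1≤m m≤2n with m ≤? n
... | yes m≤n = ∣m⇒∣m*n (binom n n) (h m 1≤m m≤n)
... | no  m≰n with m ∸ n in eq
...   | zero  = contradiction (m∸n≡0⇒m≤n eq) m≰n
...   | suc j = subst₂ (λ m n → m ∣ D * binom n n) n+j≡m (m+[n∸m]≡n j<n)
        (∣-trans (divides (binom (n′ + suc j) k * binom n′ j) rearranged)
                 (*-monoˡ-∣ (binom n′ n′) (leibniz∣ n D h j k (≤-reflexive (m+[n∸m]≡n j<n)))))
  where
  open ≡-Reasoning
  1+j≡ : n + suc j ≡ m
  1+j≡ = trans (cong (n +_) (sym eq)) (m+[n∸m]≡n (<⇒≤ (≰⇒> m≰n)))
  j<n : suc j ≤ n
  j<n = +-cancelˡ-≤ n _ _ (≤-trans (≤-reflexive 1+j≡) m≤2n)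
  k = n ∸ suc j
  n′ = suc j + k
  n+j≡m : n′ + suc j ≡ m
  n+j≡m = trans (cong (_+ suc j) (m+[n∸m]≡n j<n)) 1+j≡
  shuffle : ∀ s x c → s * x * c ≡ s * (c * x)
  shuffle = solve-∀
  shuffle₂ : ∀ s x y → s * (x * y) ≡ x * (s * y)
  shuffle₂ = solve-∀
  shuffle₃ : ∀ x m y → x * (m * y) ≡ x * y * m
  shuffle₃ = solve-∀
  rearranged : suc j * binom (suc j) k * binom n′ n′ ≡ binom (n′ + suc j) k * binom n′ j * (n′ + suc j)
  rearranged = begin
    suc j * binom (suc j) k * binom n′ n′                     ≡⟨ shuffle (suc j) (binom (suc j) k) (binom n′ n′) ⟩
    suc j * (binom n′ n′ * binom (suc j) k)                   ≡⟨ cong (suc j *_) (binom-revision (suc j) k) ⟩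
    suc j * (binom (n′ + suc j) k * binom n′ (suc j))         ≡⟨ shuffle₂ (suc j) (binom (n′ + suc j) k) (binom n′ (suc j)) ⟩
    binom (n′ + suc j) k * (suc j * binom n′ (suc j))         ≡⟨ cong (binom (n′ + suc j) k *_) (binom-absorbʳ n′ j) ⟩
    binom (n′ + suc j) k * ((suc n′ + j) * binom n′ j)        ≡⟨ cong (λ t → binom (n′ + suc j) k * (t * binom n′ j)) (sym (+-suc n′ j)) ⟩
    binom (n′ + suc j) k * ((n′ + suc j) * binom n′ j)        ≡⟨ shuffle₃ (binom (n′ + suc j) k) (n′ + suc j) (binom n′ j) ⟩
    binom (n′ + suc j) k * binom n′ j * (n′ + suc j)          ∎

-- This takes the place of Chebyshev's bound: whenever pᵃ ≤ 2ⁱ, the power pᵃ divides it, so it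
-- absorbs error terms of size a log p for all primes at once.
commonMultiple : ℕ → ℕ
commonMultiple zero    = 1
commonMultiple (suc i) = commonMultiple i * binom (2 ^ i) (2 ^ i)

∣commonMultiple : ∀ i m → 1 ≤ m → m ≤ 2 ^ i → m ∣ commonMultiple i
∣commonMultiple zero    m 1≤m m≤1 = subst (_∣ 1) (≤-antisym 1≤m m≤1) ∣-refl
∣commonMultiple (suc i) m 1≤m m≤ = multiples-double (2 ^ i) (commonMultiple i) (∣commonMultiple i) m 1≤m
  (subst (m ≤_) (cong (2 ^ i +_) (+-identityʳ (2 ^ i))) m≤)

commonMultiple≢0 : ∀ i → NonZero (commonMultiple i)
commonMultiple≢0 zero    = _
commonMultiple≢0 (suc i) = m*n≢0 _ _ {{commonMultiple≢0 i}} {{binom≢0 (2 ^ i) (2 ^ i)}}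

commonMultiple≤ : ∀ i → commonMultiple i ≤ 4 ^ (2 ^ i)
commonMultiple≤ zero    = s≤s z≤n
commonMultiple≤ (suc i) = begin
  commonMultiple i * binom n n       ≤⟨ *-mono-≤ (commonMultiple≤ i) (binom≤2^ n n) ⟩
  4 ^ n * 2 ^ (n + n)                ≡⟨ cong (λ t → 4 ^ n * 2 ^ (n + t)) (sym (+-identityʳ n)) ⟩
  4 ^ n * 2 ^ (2 * n)                ≡⟨ cong (4 ^ n *_) (sym (^-*-assoc 2 2 n)) ⟩
  4 ^ n * 4 ^ n                      ≡⟨ sym (^-distribˡ-+-* 4 n n) ⟩
  4 ^ (n + n)                        ≡⟨ cong (λ t → 4 ^ (n + t)) (sym (+-identityʳ n)) ⟩
  4 ^ (2 * n)                        ∎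
  where
  open ≤-Reasoning
  n = 2 ^ i

-- Powers and factorials

!*^≤[+]! : ∀ a b → a ! * a ^ b ≤ (a + b) !
!*^≤[+]! a zero    = ≤-reflexive (trans (*-identityʳ _) (cong _! (sym (+-identityʳ a))))
!*^≤[+]! a (suc b) = begin
  a ! * (a * a ^ b)        ≡⟨ swap (a !) a (a ^ b) ⟩
  a * (a ! * a ^ b)        ≤⟨ *-mono-≤ (≤-trans (m≤m+n a b) (n≤1+n _)) (!*^≤[+]! a b) ⟩
  suc (a + b) * (a + b) !  ≡⟨ cong _! (sym (+-suc a b)) ⟩
  (a + suc b) !            ∎
  where
  open ≤-Reasoning
  swap : ∀ x y z → x * (y * z) ≡ y * (x * z)
  swap = solve-∀

-- A weak form of Stirling's formula, obtained by comparing (2n)! with n! nⁿ from below and with 4ⁿ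
-- (n!)² from above.
n^n≤4^n*n! : ∀ n → n ^ n ≤ 4 ^ n * n !
n^n≤4^n*n! n = *-cancelˡ-≤ (n !) {{>-nonZero (1≤n! n)}} (begin
  n ! * n ^ n                   ≤⟨ !*^≤[+]! n n ⟩
  (n + n) !                     ≡⟨ sym (binom-! n n) ⟩
  binom n n * (n ! * n !)       ≤⟨ *-monoˡ-≤ (n ! * n !) (binom≤2^ n n) ⟩
  2 ^ (n + n) * (n ! * n !)     ≡⟨ cong (_* (n ! * n !)) (trans (^-distribˡ-+-* 2 n n) (sym (^-distribʳ-* 2 2 n))) ⟩
  4 ^ n * (n ! * n !)           ≡⟨ swap (4 ^ n) (n !) ⟩
  n ! * (4 ^ n * n !)           ∎)
  where
  open ≤-Reasoning
  swap : ∀ x y → x * (y * y) ≡ y * (x * y)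
  swap = solve-∀

-- Induction on y; the exponent has to grow only when y itself is a power of b. With b = 2^d this
-- chooses the box size.
power-above : ∀ b → 1 < b → ∀ y → 1 ≤ y → ∃[ s ] (y ≤ b ^ s × b ^ s ≤ b * y)
power-above b 1<b (suc zero) _ = 0 , ≤-refl , ≤-trans (<⇒≤ 1<b) (≤-reflexive (sym (*-identityʳ b)))
power-above b 1<b (suc y@(suc _)) _ with power-above b 1<b y (s≤s z≤n)
... | s , y≤bˢ , bˢ≤by with suc y ≤? b ^ s
...   | yes le = s , le , ≤-trans bˢ≤by (*-monoʳ-≤ b (n≤1+n y))
...   | no ¬le with ≤-antisym y≤bˢ (s≤s⁻¹ (≰⇒> ¬le))
...     | y≡bˢ = suc s , subst (λ t → suc y ≤ b * t) y≡bˢ y<by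
               , ≤-trans (≤-reflexive (cong (b *_) (sym y≡bˢ))) (*-monoʳ-≤ b (n≤1+n y))
  where
  y<by : y < b * y
  y<by = subst (_< b * y) (*-identityˡ y) (*-monoˡ-< y 1<b)

power-bracket : ∀ b → 1 < b → ∀ y → 1 ≤ y → ∃[ a ] (b ^ a ≤ y × y < b ^ suc a)
power-bracket b 1<b (suc zero) _ = 0 , ≤-refl , subst (1 <_) (sym (*-identityʳ b)) 1<b
power-bracket b 1<b (suc y@(suc _)) _ with power-bracket b 1<b y (s≤s z≤n)
... | a , bᵃ≤y , y<b¹⁺ᵃ with suc y <? b ^ suc a
...   | yes lt = a , m≤n⇒m≤1+n bᵃ≤y , lt
...   | no ¬lt = suc a , ≮⇒≥ ¬lt , <-≤-trans (s≤s y<b¹⁺ᵃ)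
  (subst (_≤ b ^ suc (suc a)) (*-identityˡ _) (*-monoˡ-< (b ^ suc a) {{m^n≢0 b (suc a) {{>-nonZero (<-trans (s≤s z≤n) 1<b)}}}} 1<b))

-- The rings ℤ[X]/(X^(2^η) + 1) as a tower of quadratic extensions

-- Zero and one are by definition images under `ι`, so that `ι` serves as the coefficient morphism
-- of the ring solver and identities with integer constants can be solved at every level of the
-- tower.
record ℤ-Algebra : Set₁ where
  infixl 6 _⊕_ _⊖_
  infixl 7 _⊗_
  infix  8 ⊝_
  field
    Carrier : Set
    _⊕_ _⊗_ : Carrier → Carrier → Carrier
    ⊝_      : Carrier → Carrier
    ι       : ℤ → Carrier
    ι-+     : ∀ m n → ι (m ℤ.+ n) ≡ ι m ⊕ ι n
    ι-*     : ∀ m n → ι (m ℤ.* n) ≡ ι m ⊗ ι n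
    ι-neg   : ∀ m → ι (ℤ.- m) ≡ ⊝ ι m
    isCommutativeRing : IsCommutativeRing _≡_ _⊕_ _⊗_ ⊝_ (ι 0ℤ) (ι 1ℤ)

  _⊖_ : Carrier → Carrier → Carrier
  a ⊖ b = a ⊕ ⊝ b

  commutativeRing : CommutativeRing 0ℓ 0ℓ
  commutativeRing = record { isCommutativeRing = isCommutativeRing }

  private
    coefficients : RawRing 0ℓ 0ℓ
    coefficients = CommutativeRing.rawRing ℤ.+-*-commutativeRing

    morphism : coefficients -Raw-AlmostCommutative⟶ fromCommutativeRing commutativeRing
    morphism = record
      { ⟦_⟧ = ι ; +-homo = ι-+ ; *-homo = ι-* ; -‿homo = ι-neg
      ; 0-homo = refl ; 1-homo = refl }

    ι≟ : WeaklyDecidable (λ m n → ι m ≡ ι n)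
    ι≟ m n = Maybe.map (cong ι) (dec⇒maybe (m ℤ.≟ n))

  open Algebra.Solver.Ring coefficients (fromCommutativeRing commutativeRing) morphism ι≟ public
    using (solve; _:=_; _:+_; _:*_; _:-_; :-_; con)

-- The ring A[Z]/(Z² - y), in which (a , b) stands for a + b Z.
module Quadratic (A : ℤ-Algebra) (y : ℤ-Algebra.Carrier A) where
  open ℤ-Algebra A

  infixl 6 _+ᵠ_
  infixl 7 _*ᵠ_
  _+ᵠ_ _*ᵠ_ : Carrier × Carrier → Carrier × Carrier → Carrier × Carrier
  (a , b) +ᵠ (c , d) = a ⊕ c , b ⊕ d
  (a , b) *ᵠ (c , d) = a ⊗ c ⊕ y ⊗ (b ⊗ d) , a ⊗ d ⊕ b ⊗ c

  negᵠ : Carrier × Carrier → Carrier × Carrier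
  negᵠ (a , b) = ⊝ a , ⊝ b

  ιᵠ : ℤ → Carrier × Carrier
  ιᵠ m = ι m , ι 0ℤ

  *ᵠ-identityˡ : ∀ u → ιᵠ 1ℤ *ᵠ u ≡ u
  *ᵠ-identityˡ (a , b) = cong₂ _,_
    (solve 3 (λ y a b → con 1ℤ :* a :+ y :* (con 0ℤ :* b) := a) refl y a b)
    (solve 2 (λ a b → con 1ℤ :* b :+ con 0ℤ :* a := b) refl a b)

  *ᵠ-comm : ∀ u v → u *ᵠ v ≡ v *ᵠ u
  *ᵠ-comm (a , b) (c , d) = cong₂ _,_
    (solve 5 (λ y a b c d → a :* c :+ y :* (b :* d) := c :* a :+ y :* (d :* b)) refl y a b c d)
    (solve 4 (λ a b c d → a :* d :+ b :* c := c :* b :+ d :* a) refl a b c d)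

  *ᵠ-assoc : ∀ u v w → (u *ᵠ v) *ᵠ w ≡ u *ᵠ (v *ᵠ w)
  *ᵠ-assoc (a , b) (c , d) (e , f) = cong₂ _,_
    (solve 7 (λ y a b c d e f →
      (a :* c :+ y :* (b :* d)) :* e :+ y :* ((a :* d :+ b :* c) :* f) :=
      a :* (c :* e :+ y :* (d :* f)) :+ y :* (b :* (c :* f :+ d :* e))) refl y a b c d e f)
    (solve 7 (λ y a b c d e f →
      (a :* c :+ y :* (b :* d)) :* f :+ (a :* d :+ b :* c) :* e :=
      a :* (c :* f :+ d :* e) :+ b :* (c :* e :+ y :* (d :* f))) refl y a b c d e f)

  *ᵠ-distribˡ : ∀ u v w → u *ᵠ (v +ᵠ w) ≡ u *ᵠ v +ᵠ u *ᵠ w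
  *ᵠ-distribˡ (a , b) (c , d) (e , f) = cong₂ _,_
    (solve 7 (λ y a b c d e f →
      a :* (c :+ e) :+ y :* (b :* (d :+ f)) :=
      (a :* c :+ y :* (b :* d)) :+ (a :* e :+ y :* (b :* f))) refl y a b c d e f)
    (solve 6 (λ a b c d e f →
      a :* (d :+ f) :+ b :* (c :+ e) := (a :* d :+ b :* c) :+ (a :* f :+ b :* e)) refl a b c d e f)

  quadratic : ℤ-Algebra
  quadratic = record
    { Carrier = Carrier × Carrier
    ; _⊕_     = _+ᵠ_
    ; _⊗_     = _*ᵠ_
    ; ⊝_      = negᵠ
    ; ι       = ιᵠ
    ; ι-+     = λ m n → cong₂ _,_ (ι-+ m n) (solve 0 (con 0ℤ := con 0ℤ :+ con 0ℤ) refl)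
    ; ι-*     = λ m n → cong₂ _,_
        (trans (ι-* m n) (solve 3 (λ y a b → a :* b := a :* b :+ y :* (con 0ℤ :* con 0ℤ)) refl y (ι m) (ι n)))
        (solve 2 (λ a b → con 0ℤ := a :* con 0ℤ :+ con 0ℤ :* b) refl (ι m) (ι n))
    ; ι-neg   = λ m → cong₂ _,_ (ι-neg m) (solve 0 (con 0ℤ := :- con 0ℤ) refl)
    ; isCommutativeRing = record
      { isRing = record
        { +-isAbelianGroup = record
          { isGroup = record
            { isMonoid = record
              { isSemigroup = record
                { isMagma = record { isEquivalence = isEquivalence ; ∙-cong = cong₂ _+ᵠ_ }
                ; assoc   = λ { (a , b) (c , d) (e , f) → cong₂ _,_ (+-assocᴬ a c e) (+-assocᴬ b d f) }
                }
              ; identity = (λ { (a , b) → cong₂ _,_ (proj₁ +-identityᴬ a) (proj₁ +-identityᴬ b) })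
                         , (λ { (a , b) → cong₂ _,_ (proj₂ +-identityᴬ a) (proj₂ +-identityᴬ b) })
              }
            ; inverse = (λ { (a , b) → cong₂ _,_ (proj₁ -‿inverseᴬ a) (proj₁ -‿inverseᴬ b) })
                      , (λ { (a , b) → cong₂ _,_ (proj₂ -‿inverseᴬ a) (proj₂ -‿inverseᴬ b) })
            ; ⁻¹-cong = cong negᵠ
            }
          ; comm = λ { (a , b) (c , d) → cong₂ _,_ (+-commᴬ a c) (+-commᴬ b d) }
          }
        ; *-cong     = cong₂ _*ᵠ_
        ; *-assoc    = *ᵠ-assoc
        ; *-identity = *ᵠ-identityˡ , λ u → trans (*ᵠ-comm u (ιᵠ 1ℤ)) (*ᵠ-identityˡ u)
        ; distrib    = *ᵠ-distribˡ , λ u v w → trans (*ᵠ-comm (v +ᵠ w) u)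
            (trans (*ᵠ-distribˡ u v w) (cong₂ _+ᵠ_ (*ᵠ-comm u v) (*ᵠ-comm u w)))
        }
      ; *-comm = *ᵠ-comm
      }
    }
    where
    open IsCommutativeRing isCommutativeRing using ()
      renaming (+-assoc to +-assocᴬ; +-identity to +-identityᴬ; -‿inverse to -‿inverseᴬ; +-comm to +-commᴬ)

integers : ℤ-Algebra
integers = record
  { Carrier = ℤ ; _⊕_ = ℤ._+_ ; _⊗_ = ℤ._*_ ; ⊝_ = ℤ.-_ ; ι = id
  ; ι-+ = λ _ _ → refl ; ι-* = λ _ _ → refl ; ι-neg = λ _ → refl
  ; isCommutativeRing = ℤ.+-*-isCommutativeRing }

-- The second component is the class of X.  An element of the next level is
-- E(X²) + X O(X²), stored as the pair (E , O).
tower : ℕ → Σ[ A ∈ ℤ-Algebra ] ℤ-Algebra.Carrier A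
tower zero    = integers , -1ℤ
tower (suc η) with A , y ← tower η = Quadratic.quadratic A y , (ℤ-Algebra.ι A 0ℤ , ℤ-Algebra.ι A 1ℤ)

module Stage (η : ℕ) where
  open ℤ-Algebra (proj₁ (tower η)) public

  X : Carrier
  X = proj₂ (tower η)

⟨_⟩ : ℕ → Set
⟨ η ⟩ = Stage.Carrier η

X⊗ : ∀ η (E O : ⟨ η ⟩) → Stage._⊗_ (suc η) (Stage.X (suc η)) (E , O) ≡ (Stage._⊗_ η (Stage.X η) O , E)
X⊗ η E O = cong₂ _,_
  (solve 3 (λ x E O → con 0ℤ :* E :+ x :* (con 1ℤ :* O) := x :* O) refl X E O)
  (solve 2 (λ E O → con 0ℤ :* O :+ con 1ℤ :* E := E) refl E O)
  where open Stage η

-- The product of E + X O with its conjugate E - X O: the square of the upper X is the lower X, so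
-- the result lies one level below.
relativeNorm : ∀ η → ⟨ suc η ⟩ → ⟨ η ⟩
relativeNorm η (E , O) = E ⊗ E ⊖ X ⊗ (O ⊗ O)
  where open Stage η

norm : ∀ η → ⟨ η ⟩ → ℤ
norm zero    a = a
norm (suc η) γ = norm η (relativeNorm η γ)

-- Size of norms

-- The sum of the absolute values of the 2^η integer coefficients.
height : ∀ η → ⟨ η ⟩ → ℕ
height zero    a       = abs a
height (suc η) (E , O) = height η E + height η O

height-⊝ : ∀ η a → height η (Stage.⊝_ η a) ≡ height η a
height-⊝ zero    a       = ℤ.∣-i∣≡∣i∣ a
height-⊝ (suc η) (E , O) = cong₂ _+_ (height-⊝ η E) (height-⊝ η O)

height-⊕ : ∀ η a b → height η (Stage._⊕_ η a b) ≤ height η a + height η b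
height-⊕ zero    a       b         = ℤ.∣i+j∣≤∣i∣+∣j∣ a b
height-⊕ (suc η) (E , O) (E′ , O′) = ≤-trans (+-mono-≤ (height-⊕ η E E′) (height-⊕ η O O′))
  (≤-reflexive (interchange (height η E) (height η E′) (height η O) (height η O′)))
  where
  interchange : ∀ a b c d → (a + b) + (c + d) ≡ (a + c) + (b + d)
  interchange = solve-∀

height-X⊗ : ∀ η a → height η (Stage._⊗_ η (Stage.X η) a) ≡ height η a
height-X⊗ zero    a       = trans (cong abs (ℤ.-1*i≡-i a)) (ℤ.∣-i∣≡∣i∣ a)
height-X⊗ (suc η) (E , O) = trans (cong (height (suc η)) (X⊗ η E O))
  (trans (cong (_+ height η E) (height-X⊗ η O)) (+-comm (height η O) (height η E)))

-- Multiplication by X only permutes the coefficients up to sign, so reducing modulo X^(2^η) + 1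
-- costs nothing and the constant is 1.
height-⊗ : ∀ η a b → height η (Stage._⊗_ η a b) ≤ height η a * height η b
height-⊗ zero    a       b         = ≤-reflexive (ℤ.abs-* a b)
height-⊗ (suc η) (E , O) (E′ , O′) = begin
  h (E ⊗ E′ ⊕ X ⊗ (O ⊗ O′)) + h (E ⊗ O′ ⊕ O ⊗ E′)
    ≤⟨ +-mono-≤ (height-⊕ η _ _) (height-⊕ η _ _) ⟩
  (h (E ⊗ E′) + h (X ⊗ (O ⊗ O′))) + (h (E ⊗ O′) + h (O ⊗ E′))
    ≡⟨ cong (λ t → (h (E ⊗ E′) + t) + (h (E ⊗ O′) + h (O ⊗ E′))) (height-X⊗ η (O ⊗ O′)) ⟩
  (h (E ⊗ E′) + h (O ⊗ O′)) + (h (E ⊗ O′) + h (O ⊗ E′))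
    ≤⟨ +-mono-≤ (+-mono-≤ (height-⊗ η E E′) (height-⊗ η O O′)) (+-mono-≤ (height-⊗ η E O′) (height-⊗ η O E′)) ⟩
  (h E * h E′ + h O * h O′) + (h E * h O′ + h O * h E′)
    ≡⟨ factor (h E) (h O) (h E′) (h O′) ⟩
  (h E + h O) * (h E′ + h O′) ∎
  where
  open ≤-Reasoning
  open Stage η
  h : ⟨ η ⟩ → ℕ
  h = height η
  factor : ∀ a b c d → (a * c + b * d) + (a * d + b * c) ≡ (a + b) * (c + d)
  factor = solve-∀

height-relativeNorm : ∀ η γ → height η (relativeNorm η γ) ≤ height (suc η) γ * height (suc η) γ
height-relativeNorm η (E , O) = begin
  h (E ⊗ E ⊖ X ⊗ (O ⊗ O))                           ≤⟨ height-⊕ η _ _ ⟩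
  h (E ⊗ E) + h (⊝ (X ⊗ (O ⊗ O)))                   ≡⟨ cong (h (E ⊗ E) +_) (trans (height-⊝ η _) (height-X⊗ η (O ⊗ O))) ⟩
  h (E ⊗ E) + h (O ⊗ O)                             ≤⟨ +-mono-≤ (height-⊗ η E E) (height-⊗ η O O) ⟩
  h E * h E + h O * h O                     ≤⟨ m≤m+n _ (2 * (h E * h O)) ⟩
  h E * h E + h O * h O + 2 * (h E * h O) ≡⟨ square (h E) (h O) ⟩
  (h E + h O) * (h E + h O)                 ∎
  where
  open ≤-Reasoning
  open Stage η
  h : ⟨ η ⟩ → ℕ
  h = height η
  square : ∀ a b → a * a + b * b + 2 * (a * b) ≡ (a + b) * (a + b)
  square = solve-∀

abs-norm≤ : ∀ η γ → abs (norm η γ) ≤ height η γ ^ (2 ^ η)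
abs-norm≤ zero    a = ≤-reflexive (sym (*-identityʳ (abs a)))
abs-norm≤ (suc η) γ = begin
  abs (norm η (relativeNorm η γ))           ≤⟨ abs-norm≤ η (relativeNorm η γ) ⟩
  height η (relativeNorm η γ) ^ (2 ^ η)    ≤⟨ ^-monoˡ-≤ (2 ^ η) (height-relativeNorm η γ) ⟩
  (s * s) ^ (2 ^ η)                       ≡⟨ cong (λ t → (s * t) ^ (2 ^ η)) (sym (*-identityʳ s)) ⟩
  (s ^ 2) ^ (2 ^ η)                       ≡⟨ ^-*-assoc s 2 (2 ^ η) ⟩
  s ^ (2 * 2 ^ η)                         ∎
  where
  open ≤-Reasoning
  s = height (suc η) γ

-- Congruences

module Modulo (Q : ℕ) where
  infix 4 _≋_
  record _≋_ (a b : ℤ) : Set where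
    constructor difference
    field ∣difference : pos Q ℤ∣.∣ a ℤ.- b


  ≋-reflexive : ∀ {a b} → a ≡ b → a ≋ b
  ≋-reflexive {a} refl = difference (ℤ∣.divides 0ℤ (ℤ.+-inverseʳ a))

  ≋-refl : ∀ {a} → a ≋ a
  ≋-refl = ≋-reflexive refl

  ≋-sym : ∀ {a b} → a ≋ b → b ≋ a
  ≋-sym {a} {b} (difference d) = difference (subst (pos Q ℤ∣.∣_) (flip a b) (ℤ∣.∣m⇒∣-m d))
    where
    flip : ∀ a b → ℤ.- (a ℤ.- b) ≡ b ℤ.- a
    flip = ℤSolver.solve-∀

  ≋-trans : ∀ {a b c} → a ≋ b → b ≋ c → a ≋ c
  ≋-trans {a} {b} {c} (difference d) (difference e) =
    difference (subst (pos Q ℤ∣.∣_) (telescope a b c) (ℤ∣.∣m∣n⇒∣m+n d e))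
    where
    telescope : ∀ a b c → (a ℤ.- b) ℤ.+ (b ℤ.- c) ≡ a ℤ.- c
    telescope = ℤSolver.solve-∀

  ≋-setoid : Setoid 0ℓ 0ℓ
  ≋-setoid = record { Carrier = ℤ ; _≈_ = _≋_ ; isEquivalence = record
    { refl = ≋-refl ; sym = ≋-sym ; trans = ≋-trans } }

  module ≋-Reasoning = Relation.Binary.Reasoning.Setoid ≋-setoid

  +-cong : ∀ {a b c d} → a ≋ b → c ≋ d → a ℤ.+ c ≋ b ℤ.+ d
  +-cong {a} {b} {c} {d} (difference p) (difference q) =
    difference (subst (pos Q ℤ∣.∣_) (regroup a b c d) (ℤ∣.∣m∣n⇒∣m+n p q))
    where
    regroup : ∀ a b c d → (a ℤ.- b) ℤ.+ (c ℤ.- d) ≡ (a ℤ.+ c) ℤ.- (b ℤ.+ d)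
    regroup = ℤSolver.solve-∀

  *-cong : ∀ {a b c d} → a ≋ b → c ≋ d → a ℤ.* c ≋ b ℤ.* d
  *-cong {a} {b} {c} {d} (difference p) (difference q) =
    difference (subst (pos Q ℤ∣.∣_) (regroup a b c d)
      (ℤ∣.∣m∣n⇒∣m+n (ℤ∣.∣m⇒∣m*n c p) (ℤ∣.∣n⇒∣m*n b q)))
    where
    regroup : ∀ a b c d → (a ℤ.- b) ℤ.* c ℤ.+ b ℤ.* (c ℤ.- d) ≡ a ℤ.* c ℤ.- b ℤ.* d
    regroup = ℤSolver.solve-∀

  neg-cong : ∀ {a b} → a ≋ b → ℤ.- a ≋ ℤ.- b
  neg-cong {a} {b} (difference p) = difference (subst (pos Q ℤ∣.∣_) (regroup a b) (ℤ∣.∣m⇒∣-m p))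
    where
    regroup : ∀ a b → ℤ.- (a ℤ.- b) ≡ ℤ.- a ℤ.- ℤ.- b
    regroup = ℤSolver.solve-∀

  ^-cong : ∀ {a b} n → a ≋ b → a ℤ.^ n ≋ b ℤ.^ n
  ^-cong zero    a≋b = ≋-refl
  ^-cong (suc n) a≋b = *-cong a≋b (^-cong n a≋b)

  ≋0⇒∣ : ∀ {a} → a ≋ 0ℤ → Q ∣ abs a
  ≋0⇒∣ {a} (difference d) = subst (λ b → Q ∣ abs b) (ℤ.+-identityʳ a) (ℤ∣.∣⇒∣ᵤ d)

  ∣⇒≋0 : ∀ {a} → Q ∣ abs a → a ≋ 0ℤ
  ∣⇒≋0 {a} d = difference (subst (pos Q ℤ∣.∣_) (sym (ℤ.+-identityʳ a)) (ℤ∣.∣ᵤ⇒∣ d))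

  ≋-∣ : ∀ {a b} → a ≋ b → Q ∣ abs b → Q ∣ abs a
  ≋-∣ a≋b d = ≋0⇒∣ (≋-trans a≋b (∣⇒≋0 d))

≋-weaken : ∀ {q Q a b} → q ∣ Q → Modulo._≋_ Q a b → Modulo._≋_ q a b
≋-weaken {q} {Q} q∣Q (Modulo.difference d) = Modulo.difference (ℤ∣.∣-trans (ℤ∣.∣ᵤ⇒∣ q∣Q) d)

ℤ^-distribʳ-* : ∀ a b n → (a ℤ.* b) ℤ.^ n ≡ a ℤ.^ n ℤ.* b ℤ.^ n
ℤ^-distribʳ-* a b zero    = refl
ℤ^-distribʳ-* a b (suc n) = trans (cong (a ℤ.* b ℤ.*_) (ℤ^-distribʳ-* a b n))
  (regroup a b (a ℤ.^ n) (b ℤ.^ n))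
  where
  regroup : ∀ a b c d → a ℤ.* b ℤ.* (c ℤ.* d) ≡ a ℤ.* c ℤ.* (b ℤ.* d)
  regroup = ℤSolver.solve-∀

square^ : ∀ g n → (g ℤ.* g) ℤ.^ n ≡ g ℤ.^ (2 * n)
square^ g n = trans (cong (λ t → (g ℤ.* t) ℤ.^ n) (sym (ℤ.*-identityʳ g))) (ℤ.^-*-assoc g 2 n)

-1^odd : ∀ j → -1ℤ ℤ.^ suc (2 * j) ≡ -1ℤ
-1^odd j = cong (-1ℤ ℤ.*_) (trans (sym (ℤ.^-*-assoc -1ℤ 2 j)) (ℤ.^-zeroˡ j))

-- Evaluation at g: a ring homomorphism modulo any divisor of g^(2^η) + 1

evaluate : ∀ η → ⟨ η ⟩ → ℤ → ℤ
evaluate zero    a       g = a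
evaluate (suc η) (E , O) g = evaluate η E (g ℤ.* g) ℤ.+ g ℤ.* evaluate η O (g ℤ.* g)

evaluate-ι : ∀ η m g → evaluate η (Stage.ι η m) g ≡ m
evaluate-ι zero    m g = refl
evaluate-ι (suc η) m g = trans
  (cong₂ (λ u v → u ℤ.+ g ℤ.* v) (evaluate-ι η m (g ℤ.* g)) (evaluate-ι η 0ℤ (g ℤ.* g)))
  (drop m g)
  where
  drop : ∀ m g → m ℤ.+ g ℤ.* 0ℤ ≡ m
  drop = ℤSolver.solve-∀

evaluate-⊕ : ∀ η a b g → evaluate η (Stage._⊕_ η a b) g ≡ evaluate η a g ℤ.+ evaluate η b g
evaluate-⊕ zero    a b g = refl
evaluate-⊕ (suc η) (E , O) (E′ , O′) g = trans
  (cong₂ (λ u v → u ℤ.+ g ℤ.* v) (evaluate-⊕ η E E′ h) (evaluate-⊕ η O O′ h))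
  (regroup g (evaluate η E h) (evaluate η E′ h) (evaluate η O h) (evaluate η O′ h))
  where
  h = g ℤ.* g
  regroup : ∀ g a b c d → (a ℤ.+ b) ℤ.+ g ℤ.* (c ℤ.+ d) ≡ (a ℤ.+ g ℤ.* c) ℤ.+ (b ℤ.+ g ℤ.* d)
  regroup = ℤSolver.solve-∀

evaluate-⊝ : ∀ η a g → evaluate η (Stage.⊝_ η a) g ≡ ℤ.- evaluate η a g
evaluate-⊝ zero    a g = refl
evaluate-⊝ (suc η) (E , O) g = trans
  (cong₂ (λ u v → u ℤ.+ g ℤ.* v) (evaluate-⊝ η E h) (evaluate-⊝ η O h))
  (regroup g (evaluate η E h) (evaluate η O h))
  where
  h = g ℤ.* g
  regroup : ∀ g a c → ℤ.- a ℤ.+ g ℤ.* ℤ.- c ≡ ℤ.- (a ℤ.+ g ℤ.* c)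
  regroup = ℤSolver.solve-∀

evaluate-⊖ : ∀ η a b g → evaluate η (Stage._⊖_ η a b) g ≡ evaluate η a g ℤ.- evaluate η b g
evaluate-⊖ η a b g = trans (evaluate-⊕ η a _ g) (cong (λ u → evaluate η a g ℤ.+ u) (evaluate-⊝ η b g))

∏ᶻ : ℕ → (ℕ → ℤ) → ℤ
∏ᶻ zero    f = 1ℤ
∏ᶻ (suc n) f = ∏ᶻ n f ℤ.* f n

∏ᶻ-split : ∀ m n f → ∏ᶻ (m + n) f ≡ ∏ᶻ m f ℤ.* ∏ᶻ n (λ i → f (m + i))
∏ᶻ-split m zero    f = trans (cong (λ k → ∏ᶻ k f) (+-identityʳ m)) (sym (ℤ.*-identityʳ _))
∏ᶻ-split m (suc n) f = trans (cong (λ k → ∏ᶻ k f) (+-suc m n))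
  (trans (cong (ℤ._* f (m + n)) (∏ᶻ-split m n f)) (ℤ.*-assoc (∏ᶻ m f) _ _))

∏ᶻ-distrib-* : ∀ n f g → ∏ᶻ n (λ i → f i ℤ.* g i) ≡ ∏ᶻ n f ℤ.* ∏ᶻ n g
∏ᶻ-distrib-* zero    f g = refl
∏ᶻ-distrib-* (suc n) f g = trans (cong (ℤ._* (f n ℤ.* g n)) (∏ᶻ-distrib-* n f g))
  (interchange (∏ᶻ n f) (∏ᶻ n g) (f n) (g n))
  where
  interchange : ∀ a b c d → (a ℤ.* b) ℤ.* (c ℤ.* d) ≡ (a ℤ.* c) ℤ.* (b ℤ.* d)
  interchange = ℤSolver.solve-∀

∏ᶻ-double : ∀ n f → ∏ᶻ (2 * n) f ≡ ∏ᶻ n (λ j → f j ℤ.* f (n + j))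
∏ᶻ-double n f = trans (cong (λ k → ∏ᶻ (n + k) f) (+-identityʳ n))
  (trans (∏ᶻ-split n n f) (sym (∏ᶻ-distrib-* n f (λ j → f (n + j)))))

abs-∏ᶻ : ∀ n f → abs (∏ᶻ n f) ≡ ∏ n (λ i → abs (f i))
abs-∏ᶻ zero    f = refl
abs-∏ᶻ (suc n) f = trans (ℤ.abs-* (∏ᶻ n f) (f n)) (cong (_* abs (f n)) (abs-∏ᶻ n f))

-- The odd powers of a root of X^(2^η) + 1 are its roots.
conjugate : ℤ → ℕ → ℤ
conjugate g j = g ℤ.^ suc (2 * j)

conjugate-square : ∀ g j → conjugate (g ℤ.* g) j ≡ conjugate g j ℤ.* conjugate g j
conjugate-square g j = ℤ^-distribʳ-* g g (suc (2 * j))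

module _ (Q : ℕ) where
  open Modulo Q

  ∏ᶻ-cong : ∀ n {f g} → (∀ i → i < n → f i ≋ g i) → ∏ᶻ n f ≋ ∏ᶻ n g
  ∏ᶻ-cong zero    h = ≋-refl
  ∏ᶻ-cong (suc n) h = *-cong (∏ᶻ-cong n λ i i<n → h i (m<n⇒m<1+n i<n)) (h n ≤-refl)

  evaluate-cong : ∀ η a {g h} → g ≋ h → evaluate η a g ≋ evaluate η a h
  evaluate-cong zero    a       g≋h = ≋-refl
  evaluate-cong (suc η) (E , O) g≋h =
    +-cong (evaluate-cong η E (*-cong g≋h g≋h)) (*-cong g≋h (evaluate-cong η O (*-cong g≋h g≋h)))

  RootOf-1 : ℕ → ℤ → Set
  RootOf-1 η g = g ℤ.^ (2 ^ η) ≋ -1ℤ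

  root-square : ∀ η g → RootOf-1 (suc η) g → RootOf-1 η (g ℤ.* g)
  root-square η g = subst (_≋ -1ℤ) (sym (square^ g (2 ^ η)))

  root-conjugate : ∀ η g j → RootOf-1 η g → RootOf-1 η (conjugate g j)
  root-conjugate η g j root = begin
    (g ℤ.^ m) ℤ.^ n      ≡⟨ trans (ℤ.^-*-assoc g m n) (trans (cong (g ℤ.^_) (*-comm m n)) (sym (ℤ.^-*-assoc g n m))) ⟩
    (g ℤ.^ n) ℤ.^ m      ≈⟨ ^-cong m root ⟩
    -1ℤ ℤ.^ m            ≡⟨ -1^odd j ⟩
    -1ℤ                  ∎
    where
    open ≋-Reasoning
    m = suc (2 * j)
    n = 2 ^ η

  -- Only the bottom level needs a congruence: there X is -1, and the root condition says that g is
  -- -1 as well. At all higher levels the value is exactly g.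
  evaluate-X : ∀ η g → RootOf-1 η g → evaluate η (Stage.X η) g ≋ g
  evaluate-X zero    g root = ≋-trans (≋-sym root) (≋-reflexive (ℤ.^-identityʳ g))
  evaluate-X (suc η) g root = ≋-reflexive (trans
    (cong₂ (λ u v → u ℤ.+ g ℤ.* v) (evaluate-ι η 0ℤ (g ℤ.* g)) (evaluate-ι η 1ℤ (g ℤ.* g)))
    (trans (ℤ.+-identityˡ _) (ℤ.*-identityʳ g)))

  evaluate-⊗ : ∀ η a b g → RootOf-1 η g →
    evaluate η (Stage._⊗_ η a b) g ≋ evaluate η a g ℤ.* evaluate η b g
  evaluate-⊗ zero    a b g root = ≋-refl
  evaluate-⊗ (suc η) (E , O) (E′ , O′) g root = begin
    ε (E ⊗ E′ ⊕ X ⊗ (O ⊗ O′)) ℤ.+ g ℤ.* ε (E ⊗ O′ ⊕ O ⊗ E′)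
      ≡⟨ cong₂ (λ u v → u ℤ.+ g ℤ.* v) (evaluate-⊕ η _ _ h) (evaluate-⊕ η _ _ h) ⟩
    (ε (E ⊗ E′) ℤ.+ ε (X ⊗ (O ⊗ O′))) ℤ.+ g ℤ.* (ε (E ⊗ O′) ℤ.+ ε (O ⊗ E′))
      ≈⟨ +-cong (+-cong (ε-⊗ E E′) (≋-trans (ε-⊗ X (O ⊗ O′)) (*-cong (evaluate-X η h root′) (ε-⊗ O O′))))
                (*-cong (≋-refl {g}) (+-cong (ε-⊗ E O′) (ε-⊗ O E′))) ⟩
    (ε E ℤ.* ε E′ ℤ.+ g ℤ.* g ℤ.* (ε O ℤ.* ε O′)) ℤ.+ g ℤ.* (ε E ℤ.* ε O′ ℤ.+ ε O ℤ.* ε E′)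
      ≡⟨ expand g (ε E) (ε O) (ε E′) (ε O′) ⟩
    (ε E ℤ.+ g ℤ.* ε O) ℤ.* (ε E′ ℤ.+ g ℤ.* ε O′) ∎
    where
    open ≋-Reasoning
    open Stage η
    h = g ℤ.* g
    root′ = root-square η g root
    ε : ⟨ η ⟩ → ℤ
    ε a = evaluate η a h
    ε-⊗ : ∀ a b → ε (a ⊗ b) ≋ ε a ℤ.* ε b
    ε-⊗ a b = evaluate-⊗ η a b h root′
    expand : ∀ g a b c d →
      (a ℤ.* c ℤ.+ g ℤ.* g ℤ.* (b ℤ.* d)) ℤ.+ g ℤ.* (a ℤ.* d ℤ.+ b ℤ.* c) ≡
      (a ℤ.+ g ℤ.* b) ℤ.* (c ℤ.+ g ℤ.* d)
    expand = ℤSolver.solve-∀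

  -- Since t and -t have the same square, the values at t and -t are a + t b and a - t b with the
  -- same a and b.
  evaluate-relativeNorm : ∀ η γ t → RootOf-1 (suc η) t →
    evaluate η (relativeNorm η γ) (t ℤ.* t) ≋ evaluate (suc η) γ t ℤ.* evaluate (suc η) γ (ℤ.- t)
  evaluate-relativeNorm η (E , O) t root = begin
    ε (E ⊗ E ⊖ X ⊗ (O ⊗ O))
      ≡⟨ evaluate-⊖ η _ _ h ⟩
    ε (E ⊗ E) ℤ.- ε (X ⊗ (O ⊗ O))
      ≈⟨ +-cong (ε-⊗ E E) (neg-cong (≋-trans (ε-⊗ X (O ⊗ O)) (*-cong (evaluate-X η h root′) (ε-⊗ O O)))) ⟩
    ε E ℤ.* ε E ℤ.- t ℤ.* t ℤ.* (ε O ℤ.* ε O)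
      ≡⟨ factor t (ε E) (ε O) ⟩
    (ε E ℤ.+ t ℤ.* ε O) ℤ.* (ε E ℤ.+ ℤ.- t ℤ.* ε O)
      ≡⟨ cong (λ s → (ε E ℤ.+ t ℤ.* ε O) ℤ.* (evaluate η E s ℤ.+ ℤ.- t ℤ.* evaluate η O s)) (sym (neg² t)) ⟩
    evaluate (suc η) (E , O) t ℤ.* evaluate (suc η) (E , O) (ℤ.- t) ∎
    where
    open ≋-Reasoning
    open Stage η
    h = t ℤ.* t
    root′ = root-square η t root
    ε : ⟨ η ⟩ → ℤ
    ε a = evaluate η a h
    ε-⊗ : ∀ a b → ε (a ⊗ b) ≋ ε a ℤ.* ε b
    ε-⊗ a b = evaluate-⊗ η a b h root′
    factor : ∀ t a b → a ℤ.* a ℤ.- t ℤ.* t ℤ.* (b ℤ.* b) ≡ (a ℤ.+ t ℤ.* b) ℤ.* (a ℤ.+ ℤ.- t ℤ.* b)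
    factor = ℤSolver.solve-∀
    neg² : ∀ t → ℤ.- t ℤ.* ℤ.- t ≡ t ℤ.* t
    neg² = ℤSolver.solve-∀

  conjugate-opposite : ∀ η g j → RootOf-1 (suc η) g → conjugate g (2 ^ η + j) ≋ ℤ.- conjugate g j
  conjugate-opposite η g j root = begin
    g ℤ.^ suc (2 * (n + j))               ≡⟨ cong (g ℤ.^_) (exponent n j) ⟩
    g ℤ.^ (2 * n + suc (2 * j))           ≡⟨ ℤ.^-distribˡ-+-* g (2 * n) (suc (2 * j)) ⟩
    g ℤ.^ (2 * n) ℤ.* conjugate g j       ≈⟨ *-cong root (≋-refl {conjugate g j}) ⟩
    -1ℤ ℤ.* conjugate g j                 ≡⟨ ℤ.-1*i≡-i (conjugate g j) ⟩
    ℤ.- conjugate g j                     ∎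
    where
    open ≋-Reasoning
    n = 2 ^ η
    exponent : ∀ n j → suc (2 * (n + j)) ≡ 2 * n + suc (2 * j)
    exponent = solve-∀

  -- The conjugates with indices j and 2^η + j are opposite, so the factors combine in pairs to
  -- values of the relative norm at the conjugates of g².
  norm≋∏ : ∀ η γ g → RootOf-1 η g → norm η γ ≋ ∏ᶻ (2 ^ η) (λ j → evaluate η γ (conjugate g j))
  norm≋∏ zero    a g root = ≋-reflexive (sym (ℤ.*-identityˡ a))
  norm≋∏ (suc η) γ g root = begin
    norm η (relativeNorm η γ)
      ≈⟨ norm≋∏ η (relativeNorm η γ) (g ℤ.* g) (root-square η g root) ⟩
    ∏ᶻ (2 ^ η) (λ j → evaluate η (relativeNorm η γ) (conjugate (g ℤ.* g) j))
      ≈⟨ ∏ᶻ-cong (2 ^ η) (λ j _ → pair j) ⟩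
    ∏ᶻ (2 ^ η) (λ j → F j ℤ.* F (2 ^ η + j))
      ≡⟨ sym (∏ᶻ-double (2 ^ η) F) ⟩
    ∏ᶻ (2 ^ suc η) F ∎
    where
    open ≋-Reasoning
    F : ℕ → ℤ
    F j = evaluate (suc η) γ (conjugate g j)
    pair : ∀ j → evaluate η (relativeNorm η γ) (conjugate (g ℤ.* g) j) ≋ F j ℤ.* F (2 ^ η + j)
    pair j = begin
      evaluate η (relativeNorm η γ) (conjugate (g ℤ.* g) j)
        ≡⟨ cong (evaluate η (relativeNorm η γ)) (conjugate-square g j) ⟩
      evaluate η (relativeNorm η γ) (t ℤ.* t)
        ≈⟨ evaluate-relativeNorm η γ t (root-conjugate (suc η) g j root) ⟩
      F j ℤ.* evaluate (suc η) γ (ℤ.- t)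
        ≈⟨ *-cong (≋-refl {F j}) (evaluate-cong (suc η) γ (≋-sym (conjugate-opposite η g j root))) ⟩
      F j ℤ.* F (2 ^ η + j) ∎
      where t = conjugate g j

-- If z ≡ -1 modulo pᵏ with k ≥ 1 then zᵖ ≡ -1 modulo pᵏ⁺¹ for odd p, by the
-- binomial expansion of (1 - (1 + z))ᵖ.

1+u^n : ∀ u n → ∃[ r ] (1ℤ ℤ.+ u) ℤ.^ n ≡ 1ℤ ℤ.+ pos n ℤ.* u ℤ.+ u ℤ.* u ℤ.* r
1+u^n u zero    = 0ℤ , base u
  where
  base : ∀ u → 1ℤ ≡ 1ℤ ℤ.+ 0ℤ ℤ.* u ℤ.+ u ℤ.* u ℤ.* 0ℤ
  base = ℤSolver.solve-∀
1+u^n u (suc n) with r , eq ← 1+u^n u n = pos n ℤ.+ (1ℤ ℤ.+ u) ℤ.* r , (begin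
  (1ℤ ℤ.+ u) ℤ.* (1ℤ ℤ.+ u) ℤ.^ n
    ≡⟨ cong ((1ℤ ℤ.+ u) ℤ.*_) eq ⟩
  (1ℤ ℤ.+ u) ℤ.* (1ℤ ℤ.+ pos n ℤ.* u ℤ.+ u ℤ.* u ℤ.* r)
    ≡⟨ step u (pos n) r ⟩
  1ℤ ℤ.+ (1ℤ ℤ.+ pos n) ℤ.* u ℤ.+ u ℤ.* u ℤ.* (pos n ℤ.+ (1ℤ ℤ.+ u) ℤ.* r) ∎)
  where
  open ≡-Reasoning
  step : ∀ u n r → (1ℤ ℤ.+ u) ℤ.* (1ℤ ℤ.+ n ℤ.* u ℤ.+ u ℤ.* u ℤ.* r) ≡
    1ℤ ℤ.+ (1ℤ ℤ.+ n) ℤ.* u ℤ.+ u ℤ.* u ℤ.* (n ℤ.+ (1ℤ ℤ.+ u) ℤ.* r)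
  step = ℤSolver.solve-∀

-- Roots of X^(2^η) + 1 modulo powers of an odd prime

Odd : ℕ → Set
Odd n = ∃[ h ] n ≡ suc (2 * h)

even⊎odd : ∀ n → (∃[ h ] n ≡ 2 * h) ⊎ Odd n
even⊎odd zero    = inj₁ (0 , refl)
even⊎odd (suc n) with even⊎odd n
... | inj₁ (h , refl) = inj₂ (h , refl)
... | inj₂ (h , refl) = inj₁ (suc h , cong suc (sym (+-suc h (h + 0))))

prime≢2⇒odd : ∀ {p} → Prime p → p ≢ 2 → Odd p
prime≢2⇒odd {p} pr p≢2 with even⊎odd p
... | inj₂ odd = odd
... | inj₁ (h , refl) with prime⇒irreducible pr (m∣m*n {2} h)
...   | inj₂ 2≡p = contradiction (sym 2≡p) p≢2

odd-prime∤2 : ∀ {p} → Prime p → Odd p → ¬ (p ∣ 2)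
odd-prime∤2 pr (h , refl) p∣2 with h
... | zero  = ¬prime[1] pr
... | suc h = contradiction (∣⇒≤ p∣2) (<⇒≱ (s≤s (subst (2 ≤_) (sym (cong suc (+-suc h (h + 0)))) (s≤s (s≤s z≤n)))))

-1-power-lift : ∀ {p} → Odd p → ∀ k z → Modulo._≋_ (p ^ suc k) z -1ℤ →
  Modulo._≋_ (p ^ suc (suc k)) (z ℤ.^ p) -1ℤ
-1-power-lift {p} (h , p≡) k z z≋-1 with r , eq ← 1+u^n (ℤ.- (z ℤ.- -1ℤ)) p = begin
  z ℤ.^ p
    ≡⟨ cong (ℤ._^ p) (split z) ⟩
  (-1ℤ ℤ.* (1ℤ ℤ.+ u)) ℤ.^ p
    ≡⟨ ℤ^-distribʳ-* -1ℤ (1ℤ ℤ.+ u) p ⟩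
  -1ℤ ℤ.^ p ℤ.* (1ℤ ℤ.+ u) ℤ.^ p
    ≡⟨ cong₂ ℤ._*_ (trans (cong (-1ℤ ℤ.^_) p≡) (-1^odd h)) eq ⟩
  -1ℤ ℤ.* (1ℤ ℤ.+ pos p ℤ.* u ℤ.+ u ℤ.* u ℤ.* r)
    ≈⟨ *-cong (≋-refl { -1ℤ}) (+-cong (+-cong (≋-refl {1ℤ}) (∣⇒≋0 {pos p ℤ.* u} linear)) (∣⇒≋0 {u ℤ.* u ℤ.* r} quadratic)) ⟩
  -1ℤ ∎
  where
  open Modulo (p ^ suc (suc k))
  open ≋-Reasoning
  u = ℤ.- (z ℤ.- -1ℤ)
  split : ∀ z → z ≡ -1ℤ ℤ.* (1ℤ ℤ.+ ℤ.- (z ℤ.- -1ℤ))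
  split = ℤSolver.solve-∀
  pᵏ∣u : p ^ suc k ∣ abs u
  pᵏ∣u = subst (p ^ suc k ∣_) (sym (ℤ.∣-i∣≡∣i∣ (z ℤ.- -1ℤ)))
    (ℤ∣.∣⇒∣ᵤ (Modulo._≋_.∣difference z≋-1))
  linear : p ^ suc (suc k) ∣ abs (pos p ℤ.* u)
  linear = subst (p ^ suc (suc k) ∣_) (sym (ℤ.abs-* (pos p) u)) (*-monoʳ-∣ p pᵏ∣u)
  quadratic : p ^ suc (suc k) ∣ abs (u ℤ.* u ℤ.* r)
  quadratic = subst (p ^ suc (suc k) ∣_)
    (sym (trans (ℤ.abs-* (u ℤ.* u) r) (cong (_* abs r) (ℤ.abs-* u u))))
    (∣m⇒∣m*n (abs r) (*-pres-∣ {o = p} {p = p ^ suc k} (∣-trans (m∣m*n (p ^ k)) pᵏ∣u) pᵏ∣u))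

-- No Newton iteration is needed: passing from g to gᵖ raises g^(2^η) to its p-th power, which
-- improves the modulus by a factor p.
root-lift : ∀ {p} → Odd p → ∀ η {g} → RootOf-1 p η g → ∀ k → ∃[ g′ ] RootOf-1 (p ^ suc k) η g′
root-lift {p} odd η {g} root zero = g , subst (λ q → RootOf-1 q η g) (sym (*-identityʳ p)) root
root-lift {p} odd η root (suc k) with g , root′ ← root-lift odd η root k =
  g ℤ.^ p , subst (λ z → Modulo._≋_ (p ^ suc (suc k)) z -1ℤ)
    (trans (ℤ.^-*-assoc g (2 ^ η) p) (trans (cong (g ℤ.^_) (*-comm (2 ^ η) p)) (sym (ℤ.^-*-assoc g p (2 ^ η)))))
    (-1-power-lift odd k (g ℤ.^ (2 ^ η)) root′)

root-weaken : ∀ {q Q} η {g} → q ∣ Q → RootOf-1 Q η g → RootOf-1 q η g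
root-weaken η q∣Q = ≋-weaken q∣Q

prime∤root : ∀ {p} → Prime p → ∀ η t → RootOf-1 p η t → ¬ (p ∣ abs t)
prime∤root {p} pr η t root p∣t = ∣1⇒¬prime pr (≋0⇒∣ (begin
  -1ℤ             ≈⟨ ≋-sym root ⟩
  t ℤ.^ (2 ^ η)   ≈⟨ ^-cong (2 ^ η) (∣⇒≋0 p∣t) ⟩
  0ℤ ℤ.^ (2 ^ η)  ≡⟨ 0^ (2 ^ η) (m^n>0 2 η) ⟩
  0ℤ              ∎))
  where
  open Modulo p
  open ≋-Reasoning
  0^ : ∀ n → 0 < n → 0ℤ ℤ.^ n ≡ 0ℤ
  0^ (suc n) _ = refl

-- The factors a - b and a + b differ by 2b, which is prime to p, so the whole power of p falls on
-- one of them.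
difference-of-squares : ∀ {p} → Prime p → Odd p → ∀ k a b → ¬ (p ∣ abs b) →
  p ^ k ∣ abs (a ℤ.* a ℤ.- b ℤ.* b) → p ^ k ∣ abs (a ℤ.- b) ⊎ p ^ k ∣ abs (a ℤ.- ℤ.- b)
difference-of-squares {p} pr odd k a b p∤b d =
  prime-power-∣⊎∣ pr k (abs (a ℤ.- b)) (abs (a ℤ.- ℤ.- b)) ¬both
    (subst (p ^ k ∣_) (trans (cong abs (factor a b)) (ℤ.abs-* (a ℤ.- b) (a ℤ.- ℤ.- b))) d)
  where
  factor : ∀ a b → a ℤ.* a ℤ.- b ℤ.* b ≡ (a ℤ.- b) ℤ.* (a ℤ.- ℤ.- b)
  factor = ℤSolver.solve-∀
  twice : ∀ a b → (a ℤ.- ℤ.- b) ℤ.- (a ℤ.- b) ≡ pos 2 ℤ.* b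
  twice = ℤSolver.solve-∀
  ¬both : ¬ (p ∣ abs (a ℤ.- b) × p ∣ abs (a ℤ.- ℤ.- b))
  ¬both (d₁ , d₂) with euclidsLemma 2 (abs b) pr
    (subst (p ∣_) (trans (cong abs (twice a b)) (ℤ.abs-* (pos 2) b))
      (ℤ∣.∣⇒∣ᵤ (ℤ∣.∣m∣n⇒∣m-n (ℤ∣.∣ᵤ⇒∣ {pos p} {a ℤ.- ℤ.- b} d₂) (ℤ∣.∣ᵤ⇒∣ {pos p} {a ℤ.- b} d₁))))
  ... | inj₁ p∣2 = odd-prime∤2 pr odd p∣2
  ... | inj₂ p∣b = p∤b p∣b

-- Induction on the level: n² is a conjugate of g², that is, the square of a conjugate t of g. As t
-- is prime to p, n is t or -t, and -t is again a conjugate of g.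
root⇒conjugate : ∀ {p} → Prime p → Odd p → ∀ k η g n →
  RootOf-1 (p ^ suc k) η g → RootOf-1 (p ^ suc k) η n →
  ∃[ j ] (j < 2 ^ η × Modulo._≋_ (p ^ suc k) n (conjugate g j))
root⇒conjugate {p} pr odd k zero g n rg rn = 0 , s≤s z≤n , ≋-trans
  (≋-reflexive (sym (ℤ.^-identityʳ n))) (≋-trans rn (≋-sym rg))
  where open Modulo (p ^ suc k)
root⇒conjugate {p} pr odd k (suc η) g n rg rn =
  step (root⇒conjugate pr odd k η (g ℤ.* g) (n ℤ.* n) (root-square q η g rg) (root-square q η n rn))
  where
  q = p ^ suc k
  open Modulo q
  choose : ∀ j → j < 2 ^ η → q ∣ abs (n ℤ.- conjugate g j) ⊎ q ∣ abs (n ℤ.- ℤ.- conjugate g j) →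
    ∃[ i ] (i < 2 ^ suc η × n ≋ conjugate g i)
  choose j j<2^η (inj₁ d) = j , <-≤-trans j<2^η (m≤m+n (2 ^ η) _) , difference (ℤ∣.∣ᵤ⇒∣ d)
  choose j j<2^η (inj₂ d) = 2 ^ η + j
    , subst (λ t → 2 ^ η + j < 2 ^ η + t) (sym (+-identityʳ (2 ^ η))) (+-monoʳ-< (2 ^ η) j<2^η)
    , ≋-trans {n} {ℤ.- conjugate g j} (difference (ℤ∣.∣ᵤ⇒∣ d)) (≋-sym (conjugate-opposite q η g j rg))
  step : ∃[ j ] (j < 2 ^ η × n ℤ.* n ≋ conjugate (g ℤ.* g) j) →
    ∃[ i ] (i < 2 ^ suc η × n ≋ conjugate g i)
  step (j , j<2^η , difference n²≋) = choose j j<2^η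
    (difference-of-squares pr odd (suc k) n (conjugate g j)
      (prime∤root pr (suc η) (conjugate g j)
        (root-weaken (suc η) {conjugate g j} (m∣m*n (p ^ k)) (root-conjugate q (suc η) g j rg)))
      (ℤ∣.∣⇒∣ᵤ (subst (λ s → pos q ℤ∣.∣ n ℤ.* n ℤ.- s) (conjugate-square g j) n²≋)))

-- The norm is known only modulo the number of which g is a root. The exponent 2^η K suffices
-- because each of the 2^η truncated multiplicities is at most `K`.
^∣norm : ∀ p K η γ g → RootOf-1 (p ^ (2 ^ η * K)) η g →
  p ^ ∑[ j < 2 ^ η ] powersDividing p K (abs (evaluate η γ (conjugate g j))) ∣ abs (norm η γ)
^∣norm p K η γ g root = Modulo.≋-∣ (p ^ total)
  (≋-weaken (^-monoʳ-∣ p (∑-≤-const (2 ^ η) K λ j _ → bound (abs (F j))))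
    (norm≋∏ (p ^ (2 ^ η * K)) η γ g root))
  (subst (p ^ total ∣_) (sym (abs-∏ᶻ (2 ^ η) F))
    (^∑∣∏ p (2 ^ η) (λ j → powersDividing p K (abs (F j))) (abs ∘ F) λ j _ → ^powersDividing∣ p K (abs (F j))))
  where
  F : ℕ → ℤ
  F j = evaluate η γ (conjugate g j)
  total = ∑[ j < 2 ^ η ] powersDividing p K (abs (F j))
  bound : ∀ m → powersDividing p K m ≤ K
  bound m = ≤-trans (∑-≤-const K 1 λ k _ → 𝟙≤1 (p ^ suc k ∣? m)) (≤-reflexive (*-identityʳ K))

-- Nonvanishing of norms, by descent along the prime λ = 1 - X above 2:
-- norm (λ γ) = 2 norm γ, every element of even norm is a multiple of λ, and
-- λ^(2^η) is a multiple of 2.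

λ· : ∀ η → ⟨ η ⟩ → ⟨ η ⟩
λ· η γ = γ ⊖ X ⊗ γ
  where open Stage η

λ·-pair : ∀ η E O → λ· (suc η) (E , O) ≡ (Stage._⊖_ η E (Stage._⊗_ η (Stage.X η) O) , Stage._⊖_ η O E)
λ·-pair η E O = cong (Stage._⊖_ (suc η) (E , O)) (X⊗ η E O)

relativeNorm-λ· : ∀ η γ → relativeNorm η (λ· (suc η) γ) ≡ λ· η (relativeNorm η γ)
relativeNorm-λ· η (E , O) = trans (cong (relativeNorm η) (λ·-pair η E O))
  (solve 3 (λ x e o →
    (e :- x :* o) :* (e :- x :* o) :- x :* ((o :- e) :* (o :- e)) :=
    (e :* e :- x :* (o :* o)) :- x :* (e :* e :- x :* (o :* o))) refl X E O)
  where open Stage η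

norm-λ· : ∀ η γ → norm η (λ· η γ) ≡ pos 2 ℤ.* norm η γ
norm-λ· zero    a = double a
  where
  double : ∀ a → a ℤ.- -1ℤ ℤ.* a ≡ pos 2 ℤ.* a
  double = ℤSolver.solve-∀
norm-λ· (suc η) γ = trans (cong (norm η) (relativeNorm-λ· η γ)) (norm-λ· η (relativeNorm η γ))

-- The components of λ (E′ , O′) are E′ - X O′ and O′ - E′, with sum λ O′. Hence O′ must be the
-- quotient of E + O one level below, which exists because E + O has the same value at 1 as (E , O).
λ·-divide : ∀ η γ → 2 ∣ abs (evaluate η γ 1ℤ) → ∃[ δ ] γ ≡ λ· η δ
λ·-divide zero a 2∣a with ℤ∣.divides b a≡b*2 ← ℤ∣.∣ᵤ⇒∣ {pos 2} {a} 2∣a =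
  b , trans a≡b*2 (double b)
  where
  double : ∀ b → b ℤ.* pos 2 ≡ b ℤ.- -1ℤ ℤ.* b
  double = ℤSolver.solve-∀
λ·-divide (suc η) (E , O) 2∣
  with δ , eq ← λ·-divide η (Stage._⊕_ η E O) (subst (λ t → 2 ∣ abs t)
    (trans (cong (λ t → evaluate η E 1ℤ ℤ.+ t) (ℤ.*-identityˡ _)) (sym (evaluate-⊕ η E O 1ℤ))) 2∣)
  = (δ ⊖ O , δ) , sym (trans (λ·-pair η (δ ⊖ O) δ) (cong₂ _,_ first second))
  where
  open Stage η
  open ≡-Reasoning
  first : δ ⊖ O ⊖ X ⊗ δ ≡ E
  first = begin
    δ ⊖ O ⊖ X ⊗ δ    ≡⟨ solve 3 (λ d o t → d :- o :- t := (d :- t) :- o) refl δ O (X ⊗ δ) ⟩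
    λ· η δ ⊖ O       ≡⟨ cong (_⊖ O) (sym eq) ⟩
    E ⊕ O ⊖ O        ≡⟨ solve 2 (λ e o → e :+ o :- o := e) refl E O ⟩
    E                ∎
  second : δ ⊖ (δ ⊖ O) ≡ O
  second = solve 2 (λ d o → d :- (d :- o) := o) refl δ O

-- Modulo 2 the number 1 is a root of X^(2^η) + 1 and all its conjugates are 1, so the norm is
-- congruent to a power of the value at 1.
norm≡0⇒even : ∀ η γ → norm η γ ≡ 0ℤ → 2 ∣ abs (evaluate η γ 1ℤ)
norm≡0⇒even η γ norm≡0 = value (prime∣∏⇒∣ prime[2] (2 ^ η) _ (subst (2 ∣_) (abs-∏ᶻ (2 ^ η) F)
  (≋0⇒∣ (≋-trans (≋-sym (norm≋∏ 2 η γ 1ℤ root)) (≋-reflexive norm≡0)))))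
  where
  open Modulo 2
  F : ℕ → ℤ
  F j = evaluate η γ (conjugate 1ℤ j)
  root : RootOf-1 2 η 1ℤ
  root = ≋-trans (≋-reflexive (ℤ.^-zeroˡ (2 ^ η))) (difference (ℤ∣.divides 1ℤ refl))
  value : ∃[ j ] (j < 2 ^ η × 2 ∣ abs (F j)) → 2 ∣ abs (evaluate η γ 1ℤ)
  value (j , _ , 2∣Fj) = subst (λ t → 2 ∣ abs (evaluate η γ t)) (ℤ.^-zeroˡ (suc (2 * j))) 2∣Fj

λ^ : ∀ η → ℕ → ⟨ η ⟩ → ⟨ η ⟩
λ^ η zero    γ = γ
λ^ η (suc k) γ = λ· η (λ^ η k γ)

norm≡0⇒λ^ : ∀ η k γ → norm η γ ≡ 0ℤ → ∃[ δ ] (γ ≡ λ^ η k δ × norm η δ ≡ 0ℤ)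
norm≡0⇒λ^ η zero    γ norm≡0 = γ , refl , norm≡0
norm≡0⇒λ^ η (suc k) γ norm≡0 =
  let δ , γ≡λδ = λ·-divide η γ (norm≡0⇒even η γ norm≡0)
      2norm≡0 = trans (sym (norm-λ· η δ)) (trans (cong (norm η) (sym γ≡λδ)) norm≡0)
      ε , δ≡λᵏε , normε≡0 = norm≡0⇒λ^ η k δ (ℤ.*-cancelˡ-≡ (pos 2) (norm η δ) 0ℤ 2norm≡0)
  in ε , trans γ≡λδ (cong (λ· η) δ≡λᵏε) , normε≡0

-- Congruence modulo 2 in the ring.
_~_ : ∀ {η} → ⟨ η ⟩ → ⟨ η ⟩ → Set
_~_ {η} a b = ∃[ c ] a ≡ b ⊕ (c ⊕ c)
  where open Stage η

~-trans : ∀ η {a b c} → _~_ {η} a b → _~_ {η} b c → _~_ {η} a c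
~-trans η {c = c} (d , refl) (e , refl) = e ⊕ d ,
  solve 3 (λ c d e → c :+ (e :+ e) :+ (d :+ d) := c :+ ((e :+ d) :+ (e :+ d))) refl c d e
  where open Stage η

λ·-~ : ∀ η {a b} → _~_ {η} a b → _~_ {η} (λ· η a) (λ· η b)
λ·-~ η {b = b} (c , refl) = λ· η c ,
  solve 3 (λ x b c → (b :+ (c :+ c)) :- x :* (b :+ (c :+ c)) :=
    (b :- x :* b) :+ ((c :- x :* c) :+ (c :- x :* c))) refl X b c
  where open Stage η

-- Modulo 2 one has (1 - X)² ≡ 1 - X², and X² is the X of the level below. So λ² acts on each
-- component as the lower λ.
λ·²-~ : ∀ η E O → _~_ {suc η} (λ· (suc η) (λ· (suc η) (E , O))) (λ· η E , λ· η O)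
λ·²-~ η E O = (X ⊗ (E ⊖ O) , X ⊗ O ⊖ E) , trans
  (trans (cong (λ· (suc η)) (λ·-pair η E O)) (λ·-pair η (E ⊖ X ⊗ O) (O ⊖ E)))
  (cong₂ _,_
    (solve 3 (λ x e o → (e :- x :* o) :- x :* (o :- e) :=
      (e :- x :* e) :+ (x :* (e :- o) :+ x :* (e :- o))) refl X E O)
    (solve 3 (λ x e o → (o :- e) :- (e :- x :* o) :=
      (o :- x :* o) :+ ((x :* o :- e) :+ (x :* o :- e))) refl X E O))
  where open Stage η

λ^-pair-~ : ∀ η n E O → _~_ {suc η} (λ^ (suc η) (n * 2) (E , O)) (λ^ η n E , λ^ η n O)
λ^-pair-~ η zero    E O = (ι 0ℤ , ι 0ℤ) , cong₂ _,_ (zero² E) (zero² O)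
  where
  open Stage η
  zero² : ∀ a → a ≡ a ⊕ (ι 0ℤ ⊕ ι 0ℤ)
  zero² a = solve 1 (λ a → a := a :+ (con 0ℤ :+ con 0ℤ)) refl a
λ^-pair-~ η (suc n) E O = ~-trans (suc η) (λ·-~ (suc η) (λ·-~ (suc η) (λ^-pair-~ η n E O)))
  (λ·²-~ η (λ^ η n E) (λ^ η n O))

-- This is 2^η, in the form n * 2 needed to apply λ^-pair-~.
exponent : ℕ → ℕ
exponent zero    = 1
exponent (suc η) = exponent η * 2

λ^-even : ∀ η γ → ∃[ δ ] λ^ η (exponent η) γ ≡ Stage._⊕_ η δ δ
λ^-even zero    a = a , double a
  where
  double : ∀ a → a ℤ.- -1ℤ ℤ.* a ≡ a ℤ.+ a
  double = ℤSolver.solve-∀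
λ^-even (suc η) (E , O)
  with (c , d) , eq ← λ^-pair-~ η (exponent η) E O
     | δ , eqE ← λ^-even η E | ε , eqO ← λ^-even η O
  = (δ ⊕ c , ε ⊕ d) , trans eq (cong₂ _,_ (trans (cong (_⊕ (c ⊕ c)) eqE) (regroup δ c))
                                           (trans (cong (_⊕ (d ⊕ d)) eqO) (regroup ε d)))
  where
  open Stage η
  regroup : ∀ a c → a ⊕ a ⊕ (c ⊕ c) ≡ (a ⊕ c) ⊕ (a ⊕ c)
  regroup a c = solve 2 (λ a c → a :+ a :+ (c :+ c) := (a :+ c) :+ (a :+ c)) refl a c

norm-double≡0 : ∀ η γ → norm η (Stage._⊕_ η γ γ) ≡ 0ℤ → norm η γ ≡ 0ℤ
norm-double≡0 zero a eq = ℤ.*-cancelˡ-≡ (pos 2) _ _ (trans (double a) eq)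
  where
  double : ∀ a → pos 2 ℤ.* a ≡ a ℤ.+ a
  double = ℤSolver.solve-∀
-- Doubling an element multiplies its relative norm by 4, hence the two recursive calls.
norm-double≡0 (suc η) (E , O) eq = norm-double≡0 η r (norm-double≡0 η (r ⊕ r)
  (trans (cong (norm η) (sym quadruple)) eq))
  where
  open Stage η
  r = relativeNorm η (E , O)
  quadruple : relativeNorm η (E ⊕ E , O ⊕ O) ≡ (r ⊕ r) ⊕ (r ⊕ r)
  quadruple = solve 3 (λ x e o →
    (e :+ e) :* (e :+ e) :- x :* ((o :+ o) :* (o :+ o)) :=
    ((e :* e :- x :* (o :* o)) :+ (e :* e :- x :* (o :* o))) :+
    ((e :* e :- x :* (o :* o)) :+ (e :* e :- x :* (o :* o)))) refl X E O

height-double : ∀ η γ → height η (Stage._⊕_ η γ γ) ≡ 2 * height η γ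
height-double zero a = trans (cong abs (double a)) (ℤ.abs-* (pos 2) a)
  where
  double : ∀ a → a ℤ.+ a ≡ pos 2 ℤ.* a
  double = ℤSolver.solve-∀
height-double (suc η) (E , O) =
  trans (cong₂ _+_ (height-double η E) (height-double η O)) (sym (*-distribˡ-+ 2 (height η E) (height η O)))

-- Infinite descent: an element of norm 0 is a multiple of λ^(2^η), hence of the form 2δ, where δ
-- again has norm 0 and half the height. The bound `n` on the height makes the recursion structural.
norm≡0⇒height≡0 : ∀ η n γ → height η γ ≤ n → norm η γ ≡ 0ℤ → height η γ ≡ 0
norm≡0⇒height≡0 η zero    γ h≤0 norm≡0 = n≤0⇒n≡0 h≤0
norm≡0⇒height≡0 η (suc n) γ h≤n norm≡0
  with δ′ , refl , _ ← norm≡0⇒λ^ η (exponent η) γ norm≡0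
  with δ , even ← λ^-even η δ′
  = trans h≡ (cong (2 *_) (norm≡0⇒height≡0 η n δ hδ≤n (norm-double≡0 η δ (trans (cong (norm η) (sym even)) norm≡0))))
  where
  h≡ : height η (λ^ η (exponent η) δ′) ≡ 2 * height η δ
  h≡ = trans (cong (height η) even) (height-double η δ)
  half : ∀ m n → 2 * m ≤ suc n → m ≤ n
  half zero    n _         = z≤n
  half (suc m) n (s≤s le) = ≤-trans (≤-trans (s≤s (m≤m+n m 0)) (m≤n+m _ m)) le
  hδ≤n : height η δ ≤ n
  hδ≤n = half (height η δ) n (subst (_≤ suc n) h≡ h≤n)

-- The box of elements with coefficients below M

-- The 2^η coefficients are the base M digits of i. Numbering the box by i < M^(2^η) makes sums over
-- it sums over an initial segment.
digits : ∀ η M .{{_ : NonZero M}} → ℕ → ⟨ η ⟩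
digits zero    M i = pos i
digits (suc η) M i = digits η M (i % B) , digits η M (i / B)
  where
  B = M ^ (2 ^ η)
  instance _ = m^n≢0 M (2 ^ η)

box-step : ∀ η M → M ^ (2 ^ suc η) ≡ M ^ (2 ^ η) * M ^ (2 ^ η)
box-step η M = trans (cong (λ t → M ^ (2 ^ η + t)) (+-identityʳ (2 ^ η))) (^-distribˡ-+-* M (2 ^ η) (2 ^ η))

module _ (M : ℕ) .{{_ : NonZero M}} where

  height-digits : ∀ η i j → i < M ^ (2 ^ η) → j < M ^ (2 ^ η) →
    height η (Stage._⊖_ η (digits η M i) (digits η M j)) ≤ 2 ^ η * M
  height-digits zero i j i<M j<M = begin
    abs (pos i ℤ.- pos j)   ≡⟨ cong abs (ℤ.m-n≡m⊖n i j) ⟩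
    abs (i ℤ.⊖ j)           ≤⟨ ℤ.∣m⊝n∣≤m⊔n i j ⟩
    i ⊔ j                 ≤⟨ ⊔-lub (<⇒≤ i<M) (<⇒≤ j<M) ⟩
    M ^ 1                 ≡⟨ *-comm M 1 ⟩
    1 * M                 ∎
    where open ≤-Reasoning
  height-digits (suc η) i j i<B² j<B² = ≤-trans
    (+-mono-≤ (height-digits η (i % B) (j % B) (m%n<n i B) (m%n<n j B))
              (height-digits η (i / B) (j / B) (m<n*o⇒m/o<n (subst (i <_) (box-step η M) i<B²))
                                               (m<n*o⇒m/o<n (subst (j <_) (box-step η M) j<B²))))
    (≤-reflexive (trans (sym (*-distribʳ-+ M (2 ^ η) (2 ^ η)))
      (cong (λ t → (2 ^ η + t) * M) (sym (+-identityʳ (2 ^ η))))))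
    where
    B = M ^ (2 ^ η)
    instance _ = m^n≢0 M (2 ^ η)

  digits-injective : ∀ η i j → i < M ^ (2 ^ η) → j < M ^ (2 ^ η) →
    height η (Stage._⊖_ η (digits η M i) (digits η M j)) ≡ 0 → i ≡ j
  digits-injective zero i j _ _ eq = ℤ.+-injective (ℤ.i-j≡0⇒i≡j (pos i) (pos j) (ℤ.∣i∣≡0⇒i≡0 eq))
  digits-injective (suc η) i j i<B² j<B² eq = begin
    i                      ≡⟨ m≡m%n+[m/n]*n i B ⟩
    i % B + i / B * B      ≡⟨ cong₂ (λ r q → r + q * B) r≡ q≡ ⟩
    j % B + j / B * B      ≡⟨ sym (m≡m%n+[m/n]*n j B) ⟩
    j                      ∎
    where
    open ≡-Reasoning
    B = M ^ (2 ^ η)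
    instance _ = m^n≢0 M (2 ^ η)
    r≡ : i % B ≡ j % B
    r≡ = digits-injective η (i % B) (j % B) (m%n<n i B) (m%n<n j B) (m+n≡0⇒m≡0 _ eq)
    q≡ : i / B ≡ j / B
    q≡ = digits-injective η (i / B) (j / B) (m<n*o⇒m/o<n (subst (i <_) (box-step η M) i<B²))
      (m<n*o⇒m/o<n (subst (j <_) (box-step η M) j<B²)) (m+n≡0⇒n≡0 (height η (Stage._⊖_ η (digits η M (i % B)) (digits η M (j % B)))) eq)

-- Counting solutions of n^(2^η) + 1 ≡ 0 modulo prime powers

∑-blocks : ∀ q b f → (∀ s → ∑[ i < q ] f (s + i) ≤ b) → ∀ t s → ∑[ i < t * q ] f (s + i) ≤ t * b
∑-blocks q b f block zero    s = z≤n
∑-blocks q b f block (suc t) s = begin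
  ∑[ i < q + t * q ] f (s + i)                             ≡⟨ ∑-split q (t * q) (λ i → f (s + i)) ⟩
  ∑[ i < q ] f (s + i) + ∑[ i < t * q ] f (s + (q + i))    ≡⟨ cong (∑ q (λ i → f (s + i)) +_) (∑-cong (t * q) λ i _ → cong f (sym (+-assoc s q i))) ⟩
  ∑[ i < q ] f (s + i) + ∑[ i < t * q ] f (s + q + i)      ≤⟨ +-mono-≤ (block s) (∑-blocks q b f block t (s + q)) ⟩
  b + t * b                                                ∎
  where open ≤-Reasoning

pos-^ : ∀ m n → pos (m ^ n) ≡ pos m ℤ.^ n
pos-^ m zero    = refl
pos-^ m (suc n) = trans (ℤ.pos-* m (m ^ n)) (cong (pos m ℤ.*_) (pos-^ m n))

∣fη⇒root : ∀ q η n → q ∣ fη η n → RootOf-1 q η (pos n)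
∣fη⇒root q η n q∣ = Modulo.difference (subst (λ z → pos q ℤ∣.∣ z ℤ.- -1ℤ) (pos-^ n (2 ^ η)) (ℤ∣.∣ᵤ⇒∣ q∣))

∣∧<⇒≡0 : ∀ {q} n → q ∣ n → n < q → n ≡ 0
∣∧<⇒≡0 zero    _ _  = refl
∣∧<⇒≡0 (suc n) d lt = contradiction (∣⇒≤ d) (<⇒≱ lt)

∣pos-pos∣<⇒≡ : ∀ q m n → m < q → n < q → q ∣ abs (pos m ℤ.- pos n) → m ≡ n
∣pos-pos∣<⇒≡ q m n m<q n<q q∣ =
  ℤ.+-injective (ℤ.i-j≡0⇒i≡j (pos m) (pos n) (ℤ.∣i∣≡0⇒i≡0 (∣∧<⇒≡0 _ q∣ small)))
  where
  small : abs (pos m ℤ.- pos n) < q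
  small = ≤-<-trans (≤-trans (≤-reflexive (cong abs (ℤ.m-n≡m⊖n m n))) (ℤ.∣m⊝n∣≤m⊔n m n)) (⊔-pres-<m m<q n<q)

residue-count : ∀ q .{{_ : NonZero q}} N c →
  ∑[ n < N ] 𝟙 (q ∣? abs (pos (suc n) ℤ.- c)) ≤ suc (N / q)
residue-count q N c = begin
  ∑ N f                        ≤⟨ ∑-≤-extend f N≤ ⟩
  ∑ (suc (N / q) * q) f        ≤⟨ ∑-blocks q 1 f block (suc (N / q)) 0 ⟩
  suc (N / q) * 1              ≡⟨ *-identityʳ _ ⟩
  suc (N / q)                  ∎
  where
  open ≤-Reasoning
  f : ℕ → ℕ
  f n = 𝟙 (q ∣? abs (pos (suc n) ℤ.- c))
  N≤ : N ≤ suc (N / q) * q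
  N≤ = ≤-trans (≤-reflexive (m≡m%n+[m/n]*n N q)) (+-monoˡ-≤ (N / q * q) (<⇒≤ (m%n<n N q)))
  shift : ∀ s i j c → (s ℤ.+ i ℤ.- c) ℤ.- (s ℤ.+ j ℤ.- c) ≡ i ℤ.- j
  shift = ℤSolver.solve-∀
  block : ∀ s → ∑[ i < q ] f (s + i) ≤ 1
  block s = count≤1 (λ i → q ∣? abs (pos (suc (s + i)) ℤ.- c)) q λ i j i<q j<q d e →
    ∣pos-pos∣<⇒≡ q i j i<q j<q (subst (λ z → q ∣ abs z) (shift (pos (suc s)) (pos i) (pos j) c)
      (ℤ∣.∣⇒∣ᵤ (ℤ∣.∣m∣n⇒∣m-n
        (ℤ∣.∣ᵤ⇒∣ {pos q} {pos (suc (s + i)) ℤ.- c} d)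
        (ℤ∣.∣ᵤ⇒∣ {pos q} {pos (suc (s + j)) ℤ.- c} e))))

-- Every solution is congruent to one of the 2^η conjugates of g, and each residue class meets 1,
-- ..., N at most ⌊N/q⌋ + 1 times.
root-count : ∀ {p} → Prime p → Odd p → ∀ k η g N .{{_ : NonZero (p ^ suc k)}} →
  RootOf-1 (p ^ suc k) η g →
  ∑[ n < N ] 𝟙 (p ^ suc k ∣? fη η (suc n)) ≤ 2 ^ η * suc (N / p ^ suc k)
root-count {p} pr odd k η g N root = count≤labels
  (λ n → q ∣? fη η (suc n)) (λ n j → q ∣? abs (pos (suc n) ℤ.- conjugate g j)) N (2 ^ η) (suc (N / q))
  label (λ j _ → residue-count q N (conjugate g j))
  where
  q = p ^ suc k
  label : ∀ n → n < N → q ∣ fη η (suc n) →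
    ∃[ j ] (j < 2 ^ η × q ∣ abs (pos (suc n) ℤ.- conjugate g j))
  label n _ d with root⇒conjugate pr odd k η g (pos (suc n)) root (∣fη⇒root q η (suc n) d)
  ... | j , j< , Modulo.difference e = j , j< , ℤ∣.∣⇒∣ᵤ e

-- At most one of the factors m - n and m^(2^i) + n^(2^i), i < e, of
-- m^(2^e) - n^(2^e) is divisible by p, so pᵏ divides a single one of them.

power-injective : ∀ {p} → Prime p → Odd p → ∀ k e m n → ¬ (p ∣ n) → m < p ^ k → n < p ^ k →
  (∀ i → i < e → m ^ (2 ^ i) + n ^ (2 ^ i) < p ^ k) →
  p ^ k ∣ abs (pos m ℤ.^ (2 ^ e) ℤ.- pos n ℤ.^ (2 ^ e)) → m ≡ n
power-injective {p} pr odd k zero m n p∤n m< n< small d = ∣pos-pos∣<⇒≡ (p ^ k) m n m< n<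
  (subst₂ (λ a b → p ^ k ∣ abs (a ℤ.- b)) (ℤ.^-identityʳ (pos m)) (ℤ.^-identityʳ (pos n)) d)
power-injective {p} pr odd k (suc e) m n p∤n m< n< small d =
  descend (difference-of-squares pr odd k (a m) (a n) p∤a
    (subst₂ (λ u v → p ^ k ∣ abs (u ℤ.- v)) (sym (square m)) (sym (square n)) d))
  where
  a : ℕ → ℤ
  a m = pos m ℤ.^ (2 ^ e)
  square : ∀ m → a m ℤ.* a m ≡ pos m ℤ.^ (2 ^ suc e)
  square m = trans (sym (ℤ.^-distribˡ-+-* (pos m) (2 ^ e) (2 ^ e)))
    (cong (λ t → pos m ℤ.^ (2 ^ e + t)) (sym (+-identityʳ (2 ^ e))))
  p∤a : ¬ (p ∣ abs (a n))
  p∤a p∣a = p∤n (prime∣^⇒∣ pr n (2 ^ e) (subst (λ z → p ∣ abs z) (sym (pos-^ n (2 ^ e))) p∣a))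
  n≢0 : NonZero n
  n≢0 = ≢-nonZero λ { refl → p∤n (p ∣0) }
  plus : abs (a m ℤ.- ℤ.- a n) ≡ m ^ (2 ^ e) + n ^ (2 ^ e)
  plus = cong abs (trans (cong (λ t → a m ℤ.+ t) (ℤ.neg-involutive (a n)))
    (sym (cong₂ ℤ._+_ (pos-^ m (2 ^ e)) (pos-^ n (2 ^ e)))))
  descend : p ^ k ∣ abs (a m ℤ.- a n) ⊎ p ^ k ∣ abs (a m ℤ.- ℤ.- a n) → m ≡ n
  descend (inj₁ d₁) = power-injective pr odd k e m n p∤n m< n< (λ i i<e → small i (m<n⇒m<1+n i<e)) d₁
  descend (inj₂ d₂) = contradiction
    (∣⇒≤ {{>-nonZero (<-≤-trans (m^n>0 n {{n≢0}} (2 ^ e)) (m≤n+m _ _))}} (subst (p ^ k ∣_) plus d₂))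
    (<⇒≱ (small e ≤-refl))

-- The solutions are labelled by their 2^(e+1)-st powers, which are conjugates of h one after
-- another among only 2^(μ-e) values. The size of p makes this labelling injective.
large-prime-count : ∀ {p} → Prime p → Odd p → ∀ N → 2 * N < p →
  ∀ μ e k g → e ≤ μ → 2 ^ e ≤ k → RootOf-1 (p ^ k) (suc μ) g →
  ∑[ n < N ] 𝟙 (p ^ k ∣? fη (suc μ) (suc n)) ≤ 2 ^ (μ ∸ e)
large-prime-count pr odd N 2N<p μ e zero g e≤μ 2ᵉ≤0 root = contradiction 2ᵉ≤0 (<⇒≱ (m^n>0 2 e))
large-prime-count {p} pr odd N 2N<p μ e k@(suc k-1) g e≤μ 2ᵉ≤k root = ≤-trans
  (count≤labels (λ n → q ∣? fη (suc μ) (suc n)) (λ n j → q ∣? abs (power n ℤ.- conjugate h j))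
    N (2 ^ (μ ∸ e)) 1 label (λ j _ → count≤1 (λ n → q ∣? abs (power n ℤ.- conjugate h j)) N (unique j)))
  (≤-reflexive (*-identityʳ _))
  where
  q = p ^ k
  h = g ℤ.^ (2 ^ suc e)
  power : ℕ → ℤ
  power n = pos (suc n) ℤ.^ (2 ^ suc e)
  power-root : ∀ t → RootOf-1 q (suc μ) t → RootOf-1 q (μ ∸ e) (t ℤ.^ (2 ^ suc e))
  power-root t = subst (λ z → Modulo._≋_ q z -1ℤ) (sym (trans (ℤ.^-*-assoc t (2 ^ suc e) (2 ^ (μ ∸ e)))
    (cong (t ℤ.^_) (trans (sym (^-distribˡ-+-* 2 (suc e) (μ ∸ e))) (cong (λ s → 2 ^ suc s) (m+[n∸m]≡n e≤μ))))))
  label : ∀ n → n < N → q ∣ fη (suc μ) (suc n) →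
    ∃[ j ] (j < 2 ^ (μ ∸ e) × q ∣ abs (power n ℤ.- conjugate h j))
  label n _ d with root⇒conjugate pr odd k-1 (μ ∸ e) h (power n)
    (power-root g root) (power-root (pos (suc n)) (∣fη⇒root q (suc μ) (suc n) d))
  ... | j , j< , Modulo.difference e = j , j< , ℤ∣.∣⇒∣ᵤ e
  N<p : N < p
  N<p = ≤-<-trans (m≤m+n N _) 2N<p
  p≤q : p ≤ q
  p≤q = m≤m*n p (p ^ k-1) {{prime⇒^≢0 pr k-1}}
  cancel : ∀ a b c → (a ℤ.- c) ℤ.- (b ℤ.- c) ≡ a ℤ.- b
  cancel = ℤSolver.solve-∀
  -- The sum is at most (2N)^(2^i), which is below p^(2^i) because 2N < p, and 2^i ≤ 2^e ≤ k. So no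
  -- factor with a plus sign can be divisible by pᵏ.
  small : ∀ m n → m < N → n < N → ∀ i → i < suc e → suc m ^ (2 ^ i) + suc n ^ (2 ^ i) < q
  small m n m<N n<N i i≤e = begin-strict
    suc m ^ (2 ^ i) + suc n ^ (2 ^ i)   ≤⟨ +-mono-≤ (^-monoˡ-≤ (2 ^ i) m<N) (^-monoˡ-≤ (2 ^ i) n<N) ⟩
    N ^ (2 ^ i) + N ^ (2 ^ i)           ≡⟨ cong (N ^ (2 ^ i) +_) (sym (+-identityʳ _)) ⟩
    2 * N ^ (2 ^ i)                     ≤⟨ *-monoˡ-≤ (N ^ (2 ^ i)) (≤-trans (≤-reflexive (sym (^-identityʳ 2))) (^-monoʳ-≤ 2 (m^n>0 2 i))) ⟩
    2 ^ (2 ^ i) * N ^ (2 ^ i)           ≡⟨ sym (^-distribʳ-* 2 N (2 ^ i)) ⟩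
    (2 * N) ^ (2 ^ i)                   <⟨ ^-monoˡ-< (2 ^ i) {{m^n≢0 2 i}} 2N<p ⟩
    p ^ (2 ^ i)                         ≤⟨ ^-monoʳ-≤ p {{prime⇒nonZero pr}} (≤-trans (^-monoʳ-≤ 2 (s≤s⁻¹ i≤e)) 2ᵉ≤k) ⟩
    q                                   ∎
    where open ≤-Reasoning
  unique : ∀ j m n → m < N → n < N → q ∣ abs (power m ℤ.- conjugate h j) →
    q ∣ abs (power n ℤ.- conjugate h j) → m ≡ n
  unique j m n m<N n<N d e′ = suc-injective (power-injective pr odd k (suc e) (suc m) (suc n)
    (>⇒∤ (≤-<-trans n<N N<p)) (<-≤-trans (≤-<-trans m<N N<p) p≤q) (<-≤-trans (≤-<-trans n<N N<p) p≤q)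
    (small m n m<N n<N)
    (subst (λ z → q ∣ abs z) (cancel (power m) (power n) (conjugate h j)) (ℤ∣.∣⇒∣ᵤ (ℤ∣.∣m∣n⇒∣m-n
      (ℤ∣.∣ᵤ⇒∣ {pos q} {power m ℤ.- conjugate h j} d) (ℤ∣.∣ᵤ⇒∣ {pos q} {power n ℤ.- conjugate h j} e′)))))

-- The 2^e exponents k with 2^e ≤ k < 2^(e+1) contribute at most 2^(μ-e) each, hence 2^μ together.
-- The η = μ + 1 dyadic blocks below 2^η give the constant η 2^(η-1) of the theorem.
dyadic-sum : ∀ μ (c : ℕ → ℕ) → (∀ e k → e ≤ μ → 2 ^ e ≤ k → c k ≤ 2 ^ (μ ∸ e)) →
  ∀ e → e ≤ suc μ → ∑[ k < 2 ^ e ∸ 1 ] c (suc k) ≤ e * 2 ^ μ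
dyadic-sum μ c bound zero    _     = z≤n
dyadic-sum μ c bound (suc e) 1+e≤ = begin
  ∑[ k < 2 ^ suc e ∸ 1 ] c (suc k)
    ≡⟨ cong (λ n → ∑ n (c ∘ suc)) split ⟩
  ∑[ k < (2 ^ e ∸ 1) + 2 ^ e ] c (suc k)
    ≡⟨ ∑-split (2 ^ e ∸ 1) (2 ^ e) (c ∘ suc) ⟩
  ∑[ k < 2 ^ e ∸ 1 ] c (suc k) + ∑[ k < 2 ^ e ] c (suc (2 ^ e ∸ 1 + k))
    ≤⟨ +-mono-≤ (dyadic-sum μ c bound e (<⇒≤ 1+e≤)) (∑-≤-const (2 ^ e) (2 ^ (μ ∸ e)) λ k _ →
         bound e _ e≤μ (≤-trans (≤-reflexive (sym 1+)) (s≤s (m≤m+n (2 ^ e ∸ 1) k)))) ⟩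
  e * 2 ^ μ + 2 ^ e * 2 ^ (μ ∸ e)
    ≡⟨ cong (e * 2 ^ μ +_) (trans (sym (^-distribˡ-+-* 2 e (μ ∸ e))) (cong (2 ^_) (m+[n∸m]≡n e≤μ))) ⟩
  e * 2 ^ μ + 2 ^ μ
    ≡⟨ +-comm (e * 2 ^ μ) (2 ^ μ) ⟩
  suc e * 2 ^ μ ∎
  where
  open ≤-Reasoning
  e≤μ = s≤s⁻¹ 1+e≤
  1+ : suc (2 ^ e ∸ 1) ≡ 2 ^ e
  1+ = m+[n∸m]≡n (m^n>0 2 e)
  split : 2 ^ suc e ∸ 1 ≡ (2 ^ e ∸ 1) + 2 ^ e
  split = trans (cong (λ t → 2 ^ e + t ∸ 1) (+-identityʳ (2 ^ e))) (+-∸-comm (2 ^ e) (m^n>0 2 e))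

-- Multiplicities in the product of the values

∏fη : ∀ η N → prodF η N ≡ ∏[ n < N ] fη η (suc n)
∏fη η zero    = refl
∏fη η (suc N) = cong (_* fη η (suc N)) (∏fη η N)

-- Legendre's way of counting: the multiplicity of each value is the number of powers of p dividing
-- it, and the two summations are exchanged.
multiplicity-prodF : ∀ {p} → Prime p → ∀ η N K → (∀ n → n < N → fη η (suc n) < p ^ suc K) →
  MultiplicityAtMost p (∑[ k < K ] (∑[ n < N ] 𝟙 (p ^ suc k ∣? fη η (suc n)))) (prodF η N)
multiplicity-prodF {p} pr η N K f< = subst₂ (MultiplicityAtMost p)
  (∑-comm N K (λ n k → 𝟙 (p ^ suc k ∣? fη η (suc n)))) (sym (∏fη η N))
  (multiplicity-∏ pr N λ n n<N → multiplicity≤powersDividing p K (fη η (suc n))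
    (>⇒∤ {{>-nonZero (m≤n+m 1 _)}} (f< n n<N)))

prime∣prodF⇒root : ∀ {p} → Prime p → ∀ η N → p ∣ prodF η N → ∃[ g ] RootOf-1 p η g
prime∣prodF⇒root {p} pr η N d with prime∣∏⇒∣ pr N _ (subst (p ∣_) (∏fη η N) d)
... | n , _ , p∣f = pos (suc n) , ∣fη⇒root p η (suc n) p∣f

n^d+1≤[1+n]^d : ∀ n d → 1 ≤ d → n ^ d + 1 ≤ suc n ^ d
n^d+1≤[1+n]^d n d 1≤d = ≤-trans (≤-reflexive (+-comm (n ^ d) 1)) (^-monoˡ-< d {{>-nonZero 1≤d}} (n<1+n n))

-- As η ≥ 1, the value is a square plus one, hence 1 or 2 modulo 4.
4∤fη : ∀ η n → 1 ≤ η → ¬ (2 ^ 2 ∣ fη η n)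
4∤fη (suc η) n _ 4∣ with even⊎odd (n ^ (2 ^ η))
... | inj₁ (h , eq) = contradiction (∣⇒≤ (∣m+n∣m⇒∣n (subst (4 ∣_) value 4∣) (m∣m*n (h * h)))) (λ { (s≤s ()) })
  where
  value : fη (suc η) n ≡ 4 * (h * h) + 1
  value = cong (_+ 1) (trans (cong (n ^_) (*-comm 2 (2 ^ η))) (trans (sym (^-*-assoc n (2 ^ η) 2))
    (trans (cong (_^ 2) eq) (expand h))))
    where
    expand : ∀ h → (2 * h) ^ 2 ≡ 4 * (h * h)
    expand h = trans (^-distribʳ-* 2 h 2) (cong (λ t → 4 * (h * t)) (*-identityʳ h))
... | inj₂ (h , eq) = contradiction (∣⇒≤ (∣m+n∣m⇒∣n (subst (4 ∣_) value 4∣) (m∣m*n (h * h + h)))) (λ { (s≤s (s≤s ())) })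
  where
  value : fη (suc η) n ≡ 4 * (h * h + h) + 2
  value = trans (cong (_+ 1) (trans (cong (n ^_) (*-comm 2 (2 ^ η))) (trans (sym (^-*-assoc n (2 ^ η) 2))
    (trans (cong (_^ 2) eq) (cong (suc (2 * h) *_) (*-identityʳ _)))))) (expand h)
    where
    expand : ∀ h → suc (2 * h) * suc (2 * h) + 1 ≡ 4 * (h * h + h) + 2
    expand = solve-∀

multiplicity-2 : ∀ η N → 1 ≤ η → MultiplicityAtMost 2 N (prodF η N)
multiplicity-2 η N 1≤η = subst₂ (MultiplicityAtMost 2) (trans (∑-const N 1) (*-identityʳ N)) (sym (∏fη η N))
  (multiplicity-∏ prime[2] N λ n _ → at-most-one (fη η (suc n)) (4∤fη η (suc n) 1≤η))
  where
  at-most-one : ∀ m → ¬ (2 ^ 2 ∣ m) → MultiplicityAtMost 2 1 m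
  at-most-one m 4∤m k d with k ≤? 1
  ... | yes k≤1 = k≤1
  ... | no  k≰1 = contradiction (∣-trans (^-monoʳ-∣ 2 (≰⇒> k≰1)) d) 4∤m

-- If p divides P it yields a root modulo p, which lifts to all powers of p. Since f(n) ≤ (N + 1)^d
-- < p^d for n ≤ N, only the exponents below d = 2^(μ+1) matter.
multiplicity-large : ∀ {p} → Prime p → Odd p → ∀ μ N → 1 ≤ N → 2 * N < p →
  MultiplicityAtMost p (suc μ * 2 ^ μ) (prodF (suc μ) N)
multiplicity-large {p} pr odd μ N 1≤N 2N<p with p ∣? prodF (suc μ) N
... | no p∤P = multiplicity-weaken z≤n (multiplicity-∤ p∤P)
... | yes p∣P with g₀ , root₀ ← prime∣prodF⇒root pr (suc μ) N p∣P =
  multiplicity-weaken (dyadic-sum μ (λ k → ∑[ n < N ] 𝟙 (p ^ k ∣? fη (suc μ) (suc n))) bound (suc μ) ≤-refl)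
    (multiplicity-prodF pr (suc μ) N (2 ^ suc μ ∸ 1) f<)
  where
  bound : ∀ e k → e ≤ μ → 2 ^ e ≤ k → ∑[ n < N ] 𝟙 (p ^ k ∣? fη (suc μ) (suc n)) ≤ 2 ^ (μ ∸ e)
  bound e k e≤μ 2ᵉ≤k with g , root ← root-lift odd (suc μ) root₀ k =
    large-prime-count pr odd N 2N<p μ e k g e≤μ 2ᵉ≤k (root-weaken (suc μ) (^-monoʳ-∣ p (n≤1+n k)) root)
  f< : ∀ n → n < N → fη (suc μ) (suc n) < p ^ suc (2 ^ suc μ ∸ 1)
  f< n n<N = begin-strict
    suc n ^ (2 ^ suc μ) + 1          ≤⟨ n^d+1≤[1+n]^d (suc n) (2 ^ suc μ) (m^n>0 2 (suc μ)) ⟩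
    suc (suc n) ^ (2 ^ suc μ)        <⟨ ^-monoˡ-< (2 ^ suc μ) {{m^n≢0 2 (suc μ)}} 2+n<p ⟩
    p ^ (2 ^ suc μ)                  ≡⟨ cong (p ^_) (sym (m+[n∸m]≡n (m^n>0 2 (suc μ)))) ⟩
    p ^ suc (2 ^ suc μ ∸ 1)          ∎
    where
    open ≤-Reasoning
    2+n<p : suc (suc n) < p
    2+n<p = ≤-<-trans (≤-trans (≤-reflexive (+-comm 1 (suc n))) (+-mono-≤ n<N (≤-trans 1≤N (m≤m+n N 0)))) 2N<p

prime∣rad : ∀ {p} → Prime p → ∀ m .{{_ : NonZero m}} → p ∣ m → p ∣ rad m
prime∣rad {p} pr m p∣m = ∈⇒∣product
  (∈-filter⁺ (λ p → prime? p ×-dec (p ∣? m)) (∈-upTo⁺ (s≤s (∣⇒≤ p∣m))) (pr , p∣m))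

rad≢0 : ∀ m → NonZero (rad m)
rad≢0 m = productOfPrimes≢0 (map proj₁ (all-filter (λ p → prime? p ×-dec (p ∣? m)) (upTo (suc m))))

-- Differences of box elements

∑∑-comm : ∀ m n o (F : ℕ → ℕ → ℕ → ℕ) →
  ∑[ i < m ] (∑[ j < n ] (∑[ k < o ] F i j k)) ≡ ∑[ k < o ] (∑[ i < m ] (∑[ j < n ] F i j k))
∑∑-comm m n o F = trans (∑-cong m λ i _ → ∑-comm n o (F i)) (∑-comm m o (λ i k → ∑[ j < n ] F i j k))

select : ∀ {a} {A : Set a} → Dec A → ℕ → ℕ → ℕ
select (yes _) u v = u
select (no  _) u v = v

select-elim : ∀ {a} {A : Set a} (Q : ℕ → Set) (A? : Dec A) {u v} → Q u → (¬ A → Q v) → Q (select A? u v)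
select-elim Q (yes _) Qu Qv = Qu
select-elim Q (no ¬a) Qu Qv = Qv ¬a

^select∣select : ∀ {a} {A : Set a} (A? : Dec A) p {e v} → p ^ e ∣ v → p ^ select A? 0 e ∣ select A? 1 v
^select∣select (yes _) p d = ∣-refl
^select∣select (no  _) p d = d

≤select+𝟙* : ∀ {a} {A : Set a} (A? : Dec A) {e b} → e ≤ b → e ≤ select A? 0 e + 𝟙 A? * b
≤select+𝟙* (yes _) e≤b = ≤-trans e≤b (≤-reflexive (sym (+-identityʳ _)))
≤select+𝟙* (no  _) e≤b = ≤-reflexive (sym (+-identityʳ _))

powerQuotient : ∀ {p} → Prime p → ℕ → ℕ → ℕ
powerQuotient {p} pr N k = _/_ N (p ^ suc k) {{prime⇒^≢0 pr (suc k)}}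

module Differences (η M : ℕ) .{{_ : NonZero M}} where

  d x : ℕ
  d = 2 ^ η
  x = M ^ d

  δ : ℕ → ℕ → ⟨ η ⟩
  δ i j = Stage._⊖_ η (digits η M i) (digits η M j)

  -- On the diagonal the difference is 0; the factor 1 replaces its norm, which would annihilate the
  -- product.
  weight : ℕ → ℕ → ℕ
  weight i j = select (i ≟ j) 1 (abs (norm η (δ i j)))

  W : ℕ
  W = ∏[ i < x ] (∏[ j < x ] weight i j)

  weight≢0 : ∀ i j → i < x → j < x → NonZero (weight i j)
  weight≢0 i j i<x j<x = select-elim NonZero (i ≟ j) _ λ i≢j → ≢-nonZero λ norm≡0 →
    i≢j (digits-injective M η i j i<x j<x
      (norm≡0⇒height≡0 η (height η (δ i j)) (δ i j) ≤-refl (ℤ.∣i∣≡0⇒i≡0 norm≡0)))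

  W≢0 : NonZero W
  W≢0 = ∏-≢0 x λ i i<x → ∏-≢0 x λ j j<x → weight≢0 i j i<x j<x

  weight≤ : ∀ i j → i < x → j < x → weight i j ≤ (d * M) ^ d
  weight≤ i j i<x j<x = select-elim (_≤ (d * M) ^ d) (i ≟ j)
    (m^n>0 (d * M) {{m*n≢0 d M {{m^n≢0 2 η}}}} d)
    (λ _ → ≤-trans (abs-norm≤ η (δ i j)) (^-monoˡ-≤ d (height-digits M η i j i<x j<x)))

  W≤ : W ≤ ((d * M) ^ d) ^ (x * x)
  W≤ = begin
    W                                        ≤⟨ ∏-mono x (λ i i<x → ∏-mono x λ j j<x → weight≤ i j i<x j<x) ⟩
    ∏[ i < x ] (∏[ j < x ] ((d * M) ^ d))    ≤⟨ ∏-mono x (λ i _ → ≤-reflexive (∏-const x _)) ⟩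
    ∏[ i < x ] (((d * M) ^ d) ^ x)           ≡⟨ ∏-const x _ ⟩
    (((d * M) ^ d) ^ x) ^ x                  ≡⟨ ^-*-assoc _ x x ⟩
    ((d * M) ^ d) ^ (x * x)                  ∎
    where open ≤-Reasoning

  module _ {p} (pr : Prime p) (a : ℕ) (g : ℤ) (root : RootOf-1 (p ^ (d * a)) η g) where

    q : ℕ → ℕ
    q k = p ^ suc k

    q≢0 : ∀ k → NonZero (q k)
    q≢0 k = prime⇒^≢0 pr (suc k)

    class : ℕ → ℕ → ℕ → ℕ
    class j k i = _%ℕ_ (evaluate η (digits η M i) (conjugate g j)) (q k) {{q≢0 k}}

    class≡⇒∣ : ∀ j k i i′ → class j k i ≡ class j k i′ → q k ∣ abs (evaluate η (δ i i′) (conjugate g j))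
    class≡⇒∣ j k i i′ eq = ℤ∣.∣⇒∣ᵤ (ℤ∣.divides (u ÷ k ℤ.- v ÷ k) (begin
      evaluate η (δ i i′) (conjugate g j)
        ≡⟨ evaluate-⊖ η (digits η M i) (digits η M i′) (conjugate g j) ⟩
      u ℤ.- v
        ≡⟨ cong₂ ℤ._-_ (a≡a%ℕn+[a/ℕn]*n u (q k) {{q≢0 k}}) (a≡a%ℕn+[a/ℕn]*n v (q k) {{q≢0 k}}) ⟩
      (pos (class j k i) ℤ.+ u ÷ k ℤ.* pos (q k)) ℤ.- (pos (class j k i′) ℤ.+ v ÷ k ℤ.* pos (q k))
        ≡⟨ cong (λ r → (pos r ℤ.+ u ÷ k ℤ.* pos (q k)) ℤ.- (pos (class j k i′) ℤ.+ v ÷ k ℤ.* pos (q k))) eq ⟩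
      (pos (class j k i′) ℤ.+ u ÷ k ℤ.* pos (q k)) ℤ.- (pos (class j k i′) ℤ.+ v ÷ k ℤ.* pos (q k))
        ≡⟨ cancel (pos (class j k i′)) (u ÷ k) (v ÷ k) (pos (q k)) ⟩
      (u ÷ k ℤ.- v ÷ k) ℤ.* pos (q k) ∎))
      where
      open ≡-Reasoning
      infixl 8 _÷_
      _÷_ : ℤ → ℕ → ℤ
      z ÷ k = _/ℕ_ z (q k) {{q≢0 k}}
      u = evaluate η (digits η M i) (conjugate g j)
      v = evaluate η (digits η M i′) (conjugate g j)
      cancel : ∀ r s t n → (r ℤ.+ s ℤ.* n) ℤ.- (r ℤ.+ t ℤ.* n) ≡ (s ℤ.- t) ℤ.* n
      cancel = ℤSolver.solve-∀

    collision : ℕ → ℕ → ℕ → ℕ → ℕ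
    collision j k i i′ = 𝟙 (class j k i ≟ class j k i′)

    collisionsOf : ℕ → ℕ → ℕ
    collisionsOf i i′ = ∑[ j < d ] (∑[ k < a ] collision j k i i′)

    collisionsOf≤ : ∀ i i′ → collisionsOf i i′ ≤ d * a
    collisionsOf≤ i i′ = ∑-≤-const d a λ j _ →
      ≤-trans (∑-≤-const a 1 λ k _ → 𝟙≤1 (class j k i ≟ class j k i′)) (≤-reflexive (*-identityʳ a))

    weightExponent : ℕ → ℕ → ℕ
    weightExponent i i′ = select (i ≟ i′) 0 (collisionsOf i i′)

    ^weightExponent∣ : ∀ i i′ → p ^ weightExponent i i′ ∣ weight i i′
    ^weightExponent∣ i i′ = ^select∣select (i ≟ i′) p (∣-trans
      (^-monoʳ-∣ p (∑-mono d λ j _ → ∑-mono a λ k _ →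
        𝟙-mono (class j k i ≟ class j k i′) (q k ∣? abs (evaluate η (δ i i′) (conjugate g j))) (class≡⇒∣ j k i i′)))
      (^∣norm p a η (δ i i′) g root))

    collisionsOf≤weightExponent : ∀ i i′ → collisionsOf i i′ ≤ weightExponent i i′ + 𝟙 (i ≟ i′) * (d * a)
    collisionsOf≤weightExponent i i′ = ≤select+𝟙* (i ≟ i′) (collisionsOf≤ i i′)

    exponentW : ℕ
    exponentW = ∑[ i < x ] (∑[ i′ < x ] weightExponent i i′)

    ^exponentW∣W : p ^ exponentW ∣ W
    ^exponentW∣W = ^∑∣∏ p x _ _ λ i _ → ^∑∣∏ p x _ _ λ i′ _ → ^weightExponent∣ i i′

    totalCollisions : ℕ
    totalCollisions = ∑[ j < d ] (∑[ k < a ] (∑[ i < x ] (∑[ i′ < x ] collision j k i i′)))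

    -- The last term pays for the diagonal: each of the x pairs (i , i) collides for all d
    -- conjugates and all a exponents, but contributes nothing to W.
    totalCollisions≤ : totalCollisions ≤ exponentW + x * (d * a)
    totalCollisions≤ = begin
      totalCollisions
        ≡⟨ ∑-cong d (λ j _ → sym (∑∑-comm x x a (λ i i′ k → collision j k i i′))) ⟩
      ∑[ j < d ] (∑[ i < x ] (∑[ i′ < x ] (∑[ k < a ] collision j k i i′)))
        ≡⟨ sym (∑∑-comm x x d (λ i i′ j → ∑[ k < a ] collision j k i i′)) ⟩
      ∑[ i < x ] (∑[ i′ < x ] collisionsOf i i′)
        ≤⟨ ∑-mono x (λ i _ → row i) ⟩
      ∑[ i < x ] (∑[ i′ < x ] weightExponent i i′ + d * a)
        ≡⟨ trans (∑-distrib-+ x _ (λ _ → d * a)) (cong (λ t → exponentW + t) (∑-const x (d * a))) ⟩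
      exponentW + x * (d * a) ∎
      where
      open ≤-Reasoning
      row : ∀ i → ∑[ i′ < x ] collisionsOf i i′ ≤ ∑[ i′ < x ] weightExponent i i′ + d * a
      row i = begin
        ∑[ i′ < x ] collisionsOf i i′
          ≤⟨ ∑-mono x (λ i′ _ → collisionsOf≤weightExponent i i′) ⟩
        ∑[ i′ < x ] (weightExponent i i′ + 𝟙 (i ≟ i′) * (d * a))
          ≡⟨ ∑-distrib-+ x (weightExponent i) _ ⟩
        ∑[ i′ < x ] weightExponent i i′ + ∑[ i′ < x ] (𝟙 (i ≟ i′) * (d * a))
          ≡⟨ cong (λ t → ∑ x (weightExponent i) + t) (sym (*-distribʳ-∑ (d * a) x (λ i′ → 𝟙 (i ≟ i′)))) ⟩
        ∑[ i′ < x ] weightExponent i i′ + ∑[ i′ < x ] 𝟙 (i ≟ i′) * (d * a)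
          ≤⟨ +-monoʳ-≤ (∑ x (weightExponent i)) (*-monoˡ-≤ (d * a)
               (count≤1 (i ≟_) x λ _ _ _ _ e e′ → trans (sym e) e′)) ⟩
        ∑[ i′ < x ] weightExponent i i′ + 1 * (d * a)
          ≡⟨ cong (λ t → ∑ x (weightExponent i) + t) (*-identityˡ (d * a)) ⟩
        ∑[ i′ < x ] weightExponent i i′ + d * a ∎

    -- For q = p^(k+1), Cauchy-Schwarz gives x² ≤ q · pairs. Multiplying by ⌊N/q⌋ and using ⌊N/q⌋ q
    -- ≤ N compares the quotients with collision counts without any fraction.
    quotients≤exponentW : ∀ N →
      x * x * ∑[ k < a ] (d * powerQuotient pr N k) ≤ N * (exponentW + x * (d * a))
    quotients≤exponentW N = begin
      x * x * ∑[ k < a ] (d * powerQuotient pr N k)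
        ≡⟨ cong (x * x *_) (trans (sym (*-distribˡ-∑ d a (powerQuotient pr N))) (sym (∑-const d _))) ⟩
      x * x * ∑[ j < d ] (∑[ k < a ] powerQuotient pr N k)
        ≡⟨ trans (*-distribˡ-∑ (x * x) d _) (∑-cong d λ j _ → *-distribˡ-∑ (x * x) a _) ⟩
      ∑[ j < d ] (∑[ k < a ] (x * x * powerQuotient pr N k))
        ≤⟨ ∑-mono d (λ j _ → ∑-mono a λ k _ → each j k) ⟩
      ∑[ j < d ] (∑[ k < a ] (N * pairs j k))
        ≡⟨ sym (trans (*-distribˡ-∑ N d _) (∑-cong d λ j _ → *-distribˡ-∑ N a _)) ⟩
      N * totalCollisions
        ≤⟨ *-monoʳ-≤ N totalCollisions≤ ⟩
      N * (exponentW + x * (d * a)) ∎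
      where
      open ≤-Reasoning
      pairs : ℕ → ℕ → ℕ
      pairs j k = ∑[ i < x ] (∑[ i′ < x ] collision j k i i′)
      rotate : ∀ a b c → a * b * c ≡ c * a * b
      rotate = solve-∀
      each : ∀ j k → x * x * powerQuotient pr N k ≤ N * pairs j k
      each j k = begin
        x * x * powerQuotient pr N k             ≤⟨ *-monoˡ-≤ (powerQuotient pr N k) (collisions x (q k) (class j k) λ i _ → n%ℕd<d (evaluate η (digits η M i) (conjugate g j)) (q k) {{q≢0 k}}) ⟩
        q k * pairs j k * powerQuotient pr N k   ≡⟨ rotate (q k) (pairs j k) (powerQuotient pr N k) ⟩
        powerQuotient pr N k * q k * pairs j k     ≤⟨ *-monoˡ-≤ (pairs j k) (m/n*n≤m N (q k) {{q≢0 k}}) ⟩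
        N * pairs j k                 ∎

module _ {p} (pr : Prime p) (odd : Odd p) (η N a : ℕ) where

  private
    d = 2 ^ η

  -- The first a powers of p have at most d (⌊N/pᵏ⌋ + 1) solutions each. For the next d (a + 1)
  -- powers the quotient is 0, leaving d for each, and beyond them no power divides a value since
  -- f(n) ≤ (N + 1)^d ≤ p^(d (a + 1)).
  multiplicity-small : N < p ^ suc a → p ∣ prodF η N →
    MultiplicityAtMost p (∑[ k < a ] (d * powerQuotient pr N k) + a * d + d * suc a * d) (prodF η N)
  multiplicity-small N<pᵃ⁺¹ p∣P with g₀ , root₀ ← prime∣prodF⇒root pr η N p∣P =
    multiplicity-weaken total (multiplicity-prodF pr η N (a + d * suc a) f<)
    where
    open ≤-Reasoning
    C : ℕ → ℕ
    C k = ∑[ n < N ] 𝟙 (p ^ suc k ∣? fη η (suc n))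
    count : ∀ k → C k ≤ d * suc (powerQuotient pr N k)
    count k with g , root ← root-lift odd η root₀ k = root-count pr odd k η g N {{prime⇒^≢0 pr (suc k)}} root
    count-low : ∀ k → C k ≤ d * powerQuotient pr N k + d
    count-low k = ≤-trans (count k) (≤-reflexive (trans (*-suc d _) (+-comm d _)))
    count-high : ∀ k → C (a + k) ≤ d
    count-high k = ≤-trans (count (a + k)) (≤-reflexive (trans (cong (λ t → d * suc t)
      (m<n⇒m/n≡0 {{prime⇒^≢0 pr (suc (a + k))}} (<-≤-trans N<pᵃ⁺¹ (^-monoʳ-≤ p {{prime⇒nonZero pr}} (s≤s (m≤m+n a k))))))
      (*-identityʳ d)))
    total : ∑ (a + d * suc a) C ≤ ∑[ k < a ] (d * powerQuotient pr N k) + a * d + d * suc a * d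
    total = begin
      ∑ (a + d * suc a) C
        ≡⟨ ∑-split a (d * suc a) C ⟩
      ∑ a C + ∑[ k < d * suc a ] C (a + k)
        ≤⟨ +-mono-≤ (∑-mono a λ k _ → count-low k) (∑-≤-const (d * suc a) d λ k _ → count-high k) ⟩
      ∑[ k < a ] (d * powerQuotient pr N k + d) + d * suc a * d
        ≡⟨ cong (λ t → t + d * suc a * d) (trans (∑-distrib-+ a _ (λ _ → d)) (cong (λ t → ∑ a (λ k → d * powerQuotient pr N k) + t) (∑-const a d))) ⟩
      ∑[ k < a ] (d * powerQuotient pr N k) + a * d + d * suc a * d ∎
    f< : ∀ n → n < N → fη η (suc n) < p ^ suc (a + d * suc a)
    f< n n<N = begin-strict
      suc n ^ d + 1                   ≤⟨ n^d+1≤[1+n]^d (suc n) d (m^n>0 2 η) ⟩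
      suc (suc n) ^ d                 ≤⟨ ^-monoˡ-≤ d (≤-trans (s≤s n<N) N<pᵃ⁺¹) ⟩
      (p ^ suc a) ^ d                 ≡⟨ trans (^-*-assoc p (suc a) d) (cong (p ^_) (*-comm (suc a) d)) ⟩
      p ^ (d * suc a)                 <⟨ ^-monoʳ-< p (prime⇒1< pr) (s≤s (m≤n+m (d * suc a) a)) ⟩
      p ^ suc (a + d * suc a)         ∎

-- P^(x²) divides R, one prime at a time: the primes up to x are absorbed by W
-- and, for the error terms, by L, those above x by ℓ, and 2 by the last factor.

module Comparison (μ N s : ℕ) (1≤N : 1 ≤ N) where

  η d D c x : ℕ
  η = suc μ
  d = 2 ^ η
  D = η * 2 ^ μ
  -- The error exponents per unit of a: d from the diagonal of W, d from the rounding in the root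
  -- counts, and 2d² from the tail d² (a + 1) ≤ 2d² a.
  c = 2 * d + 2 * (d * d)

  private instance
    2ˢ≢0 : NonZero (2 ^ s)
    2ˢ≢0 = m^n≢0 2 s

  open Differences η (2 ^ s) using (W; W≢0; W≤; exponentW; ^exponentW∣W; quotients≤exponentW)

  x = (2 ^ s) ^ d

  P L ℓ R : ℕ
  P = prodF η N
  L = commonMultiple (s * d)
  ℓ = ℓf η N
  R = W ^ N * L ^ (c * (x * x)) * ℓ ^ (D * (x * x)) * 2 ^ (N * (x * x))

  private
    W∣R : W ^ N * L ^ (c * (x * x)) ∣ R
    W∣R = ∣m⇒∣m*n (2 ^ (N * (x * x))) (m∣m*n (ℓ ^ (D * (x * x))))

    ℓ∣R : ℓ ^ (D * (x * x)) ∣ R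
    ℓ∣R = ∣m⇒∣m*n (2 ^ (N * (x * x))) (n∣m*n (W ^ N * L ^ (c * (x * x))))

    P≢0 : NonZero P
    P≢0 = subst NonZero (sym (∏fη η N)) (∏-≢0 N λ n _ → >-nonZero (m≤n+m 1 _))

  -- The exponent is bounded by w N + a c x². The first part is supplied by W^N, the second by the
  -- power of L, because pᵃ ≤ x itself divides L.
  small-prime : N ≤ x → ∀ {p} → Prime p → Odd p → p ≤ x → p ∣ P →
    ∀ k → p ^ k ∣ P ^ (x * x) → p ^ k ∣ R
  small-prime N≤x {p} pr odd p≤x p∣P k pᵏ∣
    with power-bracket p (prime⇒1< pr) x (≤-trans 1≤N N≤x)
  -- Since p ≤ x the exponent a is positive, which the estimate a + 1 ≤ 2a requires.
  ... | zero  , _    , x<p = contradiction (subst (x <_) (*-identityʳ p) x<p) (≤⇒≯ p≤x)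
  ... | a@(suc a-1) , pᵃ≤x , x<pᵃ⁺¹
    with g₀ , root₀ ← prime∣prodF⇒root pr η N p∣P
    with g , root ← root-lift odd η root₀ (d * a) = ∣-trans (^-monoʳ-∣ p k≤) (∣-trans
      (subst (_∣ W ^ N * L ^ (c * (x * x))) (sym (^-distribˡ-+-* p (w * N) (a * (c * (x * x)))))
        (*-pres-∣ (power-∣ w N (^exponentW∣W pr a g root′)) (power-∣ a (c * (x * x))
          (∣commonMultiple (s * d) (p ^ a) (m^n>0 p {{prime⇒nonZero pr}} a) (subst (p ^ a ≤_) (^-*-assoc 2 s d) pᵃ≤x)))))
      W∣R)
    where
    open ≤-Reasoning
    root′ : RootOf-1 (p ^ (d * a)) η g
    root′ = root-weaken η (^-monoʳ-∣ p (n≤1+n (d * a))) root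
    w = exponentW pr a g root′
    power-∣ : ∀ {m} u v → p ^ u ∣ m → p ^ (u * v) ∣ m ^ v
    power-∣ {m} u v pᵘ∣m = subst (_∣ m ^ v) (^-*-assoc p u v) (^-monoˡ-∣ v pᵘ∣m)
    A = ∑[ k < a ] (d * powerQuotient pr N k)
    expand : ∀ X A a d b → X * (A + a * d + d * b * d) ≡ X * A + X * (a * d + d * d * b)
    expand = solve-∀
    expand′ : ∀ N w x d a → N * (w + x * (d * a)) ≡ w * N + N * x * (d * a)
    expand′ = solve-∀
    collect : ∀ w N X a d → w * N + X * (d * a) + X * (a * d + d * d * (2 * a)) ≡
      w * N + a * ((2 * d + 2 * (d * d)) * X)
    collect = solve-∀
    k≤ : k ≤ w * N + a * (c * (x * x))
    k≤ = begin
      k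
        ≤⟨ multiplicity-^ pr (x * x) (multiplicity-small pr odd η N a (≤-<-trans N≤x x<pᵃ⁺¹) p∣P) k pᵏ∣ ⟩
      x * x * (A + a * d + d * suc a * d)
        ≡⟨ expand (x * x) A a d (suc a) ⟩
      x * x * A + x * x * (a * d + d * d * suc a)
        ≤⟨ +-mono-≤ (quotients≤exponentW pr a g root′ N)
             (*-monoʳ-≤ (x * x) (+-monoʳ-≤ (a * d) (*-monoʳ-≤ (d * d) suc≤double))) ⟩
      N * (w + x * (d * a)) + x * x * (a * d + d * d * (2 * a))
        ≡⟨ cong (_+ x * x * (a * d + d * d * (2 * a))) (expand′ N w x d a) ⟩
      w * N + N * x * (d * a) + x * x * (a * d + d * d * (2 * a))
        -- Here N ≤ x turns the diagonal loss N x d a into an error of order x² a.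
        ≤⟨ +-monoˡ-≤ _ (+-monoʳ-≤ (w * N) (*-monoˡ-≤ (d * a) (*-monoˡ-≤ x N≤x))) ⟩
      w * N + x * x * (d * a) + x * x * (a * d + d * d * (2 * a))
        ≡⟨ collect w N (x * x) a d ⟩
      w * N + a * (c * (x * x)) ∎
      where
      suc≤double : suc a ≤ 2 * a
      suc≤double = ≤-trans (≤-reflexive (+-comm 1 a)) (+-monoʳ-≤ a (s≤s z≤n))

  local : 2 * N ≤ x → ∀ p → Prime p → ∀ k → p ^ k ∣ P ^ (x * x) → p ^ k ∣ R
  local 2N≤x p pr k pᵏ∣ with p ≟ 2
  ... | yes refl = ∣-trans (^-monoʳ-∣ 2 (≤-trans
        (multiplicity-^ pr (x * x) (multiplicity-2 η N (s≤s z≤n)) k pᵏ∣) (≤-reflexive (*-comm (x * x) N))))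
        (n∣m*n (W ^ N * L ^ (c * (x * x)) * ℓ ^ (D * (x * x))))
  ... | no p≢2 with p ∣? P
  ...   | no p∤P = subst (λ k → p ^ k ∣ R) (sym (n≤0⇒n≡0 (≤-trans
          (multiplicity-^ pr (x * x) (multiplicity-∤ p∤P) k pᵏ∣) (≤-reflexive (*-zeroʳ (x * x)))))) (1∣ R)
  ...   | yes p∣P with p ≤? x
  ...     | yes p≤x = small-prime (≤-trans (m≤m+n N _) 2N≤x) pr (prime≢2⇒odd pr p≢2) p≤x p∣P k pᵏ∣
  ...     | no  p≰x = ∣-trans (^-monoʳ-∣ p (≤-trans
            (multiplicity-^ pr (x * x) (multiplicity-large pr (prime≢2⇒odd pr p≢2) μ N 1≤N
              (≤-<-trans 2N≤x (≰⇒> p≰x))) k pᵏ∣)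
            (≤-reflexive (*-comm (x * x) D))))
          (∣-trans (^-monoˡ-∣ (D * (x * x)) (prime∣rad pr P {{P≢0}} p∣P)) ℓ∣R)

  R≢0 : NonZero R
  R≢0 = m*n≢0 (W ^ N * L ^ (c * (x * x)) * ℓ ^ (D * (x * x))) (2 ^ (N * (x * x)))
    {{m*n≢0 (W ^ N * L ^ (c * (x * x))) (ℓ ^ (D * (x * x)))
      {{m*n≢0 (W ^ N) (L ^ (c * (x * x))) {{m^n≢0 W N {{W≢0}}}} {{m^n≢0 L (c * (x * x)) {{commonMultiple≢0 (s * d)}}}}}}
      {{m^n≢0 ℓ (D * (x * x)) {{rad≢0 P}}}}}}
    {{m^n≢0 2 (N * (x * x))}}

  -- Once W is replaced by its upper bound, every exponent in R is a multiple of x², so an x²-th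
  -- root can be extracted factor by factor.
  prodF≤ : 2 * N ≤ x → P ≤ (d ^ d * x) ^ N * (4 ^ x) ^ c * ℓ ^ D * 2 ^ N
  prodF≤ 2N≤x = ^-cancelˡ-≤ (x * x) {{m*n≢0 x x {{x≢0}} {{x≢0}}}} (begin
    P ^ (x * x)
      ≤⟨ ∣⇒≤ {{R≢0}} (∣-local (P ^ (x * x)) R {{m^n≢0 P (x * x) {{P≢0}}}} (local 2N≤x)) ⟩
    W ^ N * L ^ (c * (x * x)) * ℓ ^ (D * (x * x)) * 2 ^ (N * (x * x))
      ≤⟨ *-monoˡ-≤ (2 ^ (N * (x * x))) (*-monoˡ-≤ (ℓ ^ (D * (x * x))) (*-mono-≤
           (^-monoˡ-≤ N W≤) (^-monoˡ-≤ (c * (x * x)) L≤))) ⟩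
    (B ^ (x * x)) ^ N * (4 ^ x) ^ (c * (x * x)) * ℓ ^ (D * (x * x)) * 2 ^ (N * (x * x))
      ≡⟨ cong₂ _*_ (cong₂ _*_ (cong₂ _*_ outer (sym (^-*-assoc (4 ^ x) c (x * x)))) (sym (^-*-assoc ℓ D (x * x)))) (sym (^-*-assoc 2 N (x * x))) ⟩
    (B ^ N) ^ (x * x) * ((4 ^ x) ^ c) ^ (x * x) * (ℓ ^ D) ^ (x * x) * (2 ^ N) ^ (x * x)
      ≡⟨ sym (trans (^-distribʳ-* _ _ (x * x)) (cong (_* (2 ^ N) ^ (x * x)) (trans (^-distribʳ-* _ _ (x * x))
           (cong (_* (ℓ ^ D) ^ (x * x)) (^-distribʳ-* _ _ (x * x)))))) ⟩
    (B ^ N * (4 ^ x) ^ c * ℓ ^ D * 2 ^ N) ^ (x * x)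
      ≡⟨ cong (λ b → (b ^ N * (4 ^ x) ^ c * ℓ ^ D * 2 ^ N) ^ (x * x)) (^-distribʳ-* d (2 ^ s) d) ⟩
    ((d ^ d * x) ^ N * (4 ^ x) ^ c * ℓ ^ D * 2 ^ N) ^ (x * x) ∎)
    where
    open ≤-Reasoning
    x≢0 : NonZero x
    x≢0 = m^n≢0 (2 ^ s) d
    B = (d * 2 ^ s) ^ d
    L≤ : L ≤ 4 ^ x
    L≤ = subst (λ t → L ≤ 4 ^ t) (sym (^-*-assoc 2 s d)) (commonMultiple≤ (s * d))
    outer : (B ^ (x * x)) ^ N ≡ (B ^ N) ^ (x * x)
    outer = trans (^-*-assoc B (x * x) N) (trans (cong (B ^_) (*-comm (x * x) N)) (sym (^-*-assoc B N (x * x))))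

-- The final estimate

!^≤prodF : ∀ η N → (N !) ^ (2 ^ η) ≤ prodF η N
!^≤prodF η zero    = ≤-reflexive (^-zeroˡ (2 ^ η))
!^≤prodF η (suc N) = begin
  (suc N * N !) ^ (2 ^ η)               ≡⟨ ^-distribʳ-* (suc N) (N !) (2 ^ η) ⟩
  suc N ^ (2 ^ η) * (N !) ^ (2 ^ η)     ≡⟨ *-comm (suc N ^ (2 ^ η)) _ ⟩
  (N !) ^ (2 ^ η) * suc N ^ (2 ^ η)     ≤⟨ *-mono-≤ (!^≤prodF η N) (m≤m+n _ 1) ⟩
  prodF η N * fη η (suc N)              ∎
  where open ≤-Reasoning

-- This is the logarithmic inequality exponentiated and cleared of its denominator: C_η can be any
-- positive number that is at least log K / (η 2^(η-1)).
theorem1p4 : (η : ℕ) → 1 ≤ η →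
    ∃[ K ] (1 ≤ K × ((N : ℕ) → 2 ≤ N →
    N ^ ((2 ^ η ∸ 1) * N) ≤ ℓf η N ^ (η * 2 ^ (η ∸ 1)) * K ^ N))
theorem1p4 η@(suc μ) _ = K , K≥1 , bound
  where
  d c t K₁ K : ℕ
  d = 2 ^ η
  c = 2 * d + 2 * (d * d)
  -- The least power of 2^d used for x overshoots 2N by at most a factor 2^d, so x ≤ t N.
  t = 2 ^ d * 2
  K₁ = d ^ d * t
  -- The factors come from the factorial bound, the norms (d^d x ≤ K₁ N), the common multiple L, and
  -- the prime 2.
  K = 4 ^ d * K₁ * (4 ^ t) ^ c * 2
  K≥1 : 1 ≤ K
  K≥1 = >-nonZero⁻¹ K {{m*n≢0 _ 2 {{m*n≢0 _ _ {{m*n≢0 _ _ {{m^n≢0 4 d}} {{K₁≢0}}}} {{m^n≢0 (4 ^ t) c {{m^n≢0 4 t}}}}}}}}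
    where
    K₁≢0 : NonZero K₁
    K₁≢0 = m*n≢0 (d ^ d) t {{m^n≢0 d d {{m^n≢0 2 η}}}} {{m*n≢0 (2 ^ d) 2 {{m^n≢0 2 d}}}}
  bound : ∀ N → 2 ≤ N → N ^ ((d ∸ 1) * N) ≤ ℓf η N ^ (η * 2 ^ μ) * K ^ N
  bound N 2≤N with s , 2N≤b^s , b^s≤b2N ← power-above (2 ^ d) (^-monoʳ-< 2 ≤-refl (m^n>0 2 η)) (2 * N) (≤-trans (<⇒≤ 2≤N) (m≤m+n N _)) =
    -- The cancelled N^N is the one produced on the right by (d^d x)^N; cancelling it lowers the
    -- exponent d N to (d - 1) N.
    *-cancelˡ-≤ (N ^ N) {{m^n≢0 N N {{>-nonZero (<⇒≤ 2≤N)}}}} (begin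
    N ^ N * N ^ ((d ∸ 1) * N)
      ≡⟨ trans (sym (^-distribˡ-+-* N N ((d ∸ 1) * N))) (cong (λ n → N ^ (n * N)) (m+[n∸m]≡n (m^n>0 2 η))) ⟩
    N ^ (d * N)
      ≡⟨ trans (cong (N ^_) (*-comm d N)) (sym (^-*-assoc N N d)) ⟩
    (N ^ N) ^ d
      ≤⟨ ^-monoˡ-≤ d (n^n≤4^n*n! N) ⟩
    (4 ^ N * N !) ^ d
      ≡⟨ ^-distribʳ-* (4 ^ N) (N !) d ⟩
    (4 ^ N) ^ d * (N !) ^ d
      ≤⟨ *-monoʳ-≤ ((4 ^ N) ^ d) (≤-trans (!^≤prodF η N) (prodF≤ 2N≤x)) ⟩
    (4 ^ N) ^ d * ((d ^ d * x) ^ N * (4 ^ x) ^ c * ℓ ^ D * 2 ^ N)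
      ≤⟨ *-monoʳ-≤ ((4 ^ N) ^ d) (*-monoˡ-≤ (2 ^ N) (*-monoˡ-≤ (ℓ ^ D) (*-mono-≤
           (^-monoˡ-≤ N (*-monoʳ-≤ (d ^ d) x≤tN)) (^-monoˡ-≤ c (^-monoʳ-≤ 4 x≤tN))))) ⟩
    (4 ^ N) ^ d * ((d ^ d * (t * N)) ^ N * (4 ^ (t * N)) ^ c * ℓ ^ D * 2 ^ N)
      ≡⟨ cong₂ (λ u v → u * (v * ℓ ^ D * 2 ^ N)) (^-swap 4 N d) (cong₂ _*_
           (trans (cong (_^ N) (sym (*-assoc (d ^ d) t N))) (^-distribʳ-* K₁ N N))
           (trans (cong (_^ c) (sym (^-*-assoc 4 t N))) (^-swap (4 ^ t) N c))) ⟩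
    (4 ^ d) ^ N * (K₁ ^ N * N ^ N * ((4 ^ t) ^ c) ^ N * ℓ ^ D * 2 ^ N)
      ≡⟨ regroup ((4 ^ d) ^ N) (K₁ ^ N) (N ^ N) (((4 ^ t) ^ c) ^ N) (ℓ ^ D) (2 ^ N) ⟩
    N ^ N * (ℓ ^ D * ((4 ^ d) ^ N * K₁ ^ N * ((4 ^ t) ^ c) ^ N * 2 ^ N))
      ≡⟨ cong (λ k → N ^ N * (ℓ ^ D * k)) (sym K^N) ⟩
    N ^ N * (ℓ ^ D * K ^ N) ∎)
    where
    open ≤-Reasoning
    open Comparison μ N s (<⇒≤ 2≤N) using (x; ℓ; D; prodF≤)
    x≡ : x ≡ (2 ^ d) ^ s
    x≡ = trans (^-*-assoc 2 s d) (trans (cong (2 ^_) (*-comm s d)) (sym (^-*-assoc 2 d s)))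
    2N≤x : 2 * N ≤ x
    2N≤x = subst (2 * N ≤_) (sym x≡) 2N≤b^s
    x≤tN : x ≤ t * N
    x≤tN = subst₂ _≤_ (sym x≡) (sym (*-assoc (2 ^ d) 2 N)) b^s≤b2N
    ^-swap : ∀ b m n → (b ^ m) ^ n ≡ (b ^ n) ^ m
    ^-swap b m n = trans (^-*-assoc b m n) (trans (cong (b ^_) (*-comm m n)) (sym (^-*-assoc b n m)))
    regroup : ∀ a b n e l w → a * (b * n * e * l * w) ≡ n * (l * (a * b * e * w))
    regroup = solve-∀
    K^N : K ^ N ≡ (4 ^ d) ^ N * K₁ ^ N * ((4 ^ t) ^ c) ^ N * 2 ^ N
    K^N = trans (^-distribʳ-* _ 2 N) (cong (_* 2 ^ N) (trans (^-distribʳ-* _ ((4 ^ t) ^ c) N)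
      (cong (_* ((4 ^ t) ^ c) ^ N) (^-distribʳ-* (4 ^ d) K₁ N))))
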